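{- Let $T$ be a tree on $n$ vertices with independence number $\alpha$. Then $$H(T)\le \frac{1}{24}\left(3n^2+2\alpha n+\alpha^2-9\alpha+19n-22\right),$$ with equality if and only if $T\cong A_{n,\alpha}$.
   Context: The Harary index of a connected graph $G$ is $H(G)=\sum_{\{x,y\}\subseteq V(G),\,x\ne y}\frac{1}{d(x,y)}$, $d$ the shortest-path distance. The independence number is the maximum size of a set of pairwise non-adjacent vertices. For $\frac{n-1}{2}\le m\le n-1$, the spur $A_{n,m}$ is the tree obtained from the star $S_{m+1}$ by adding a pendent edge to each of $n-m-1$ of its pendent vertices.
   Formalization: The theorem is stated for n ≥ 2: for the one-vertex tree (n = 1, α = 1) the right-hand side is −1/4 while H(T) = 0, so the inequality fails, and the spur A_{1,1} is not defined. -}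

module Defs where

open import Data.Bool using (Bool; true; false; _∧_; _∨_; if_then_else_; not)
open import Data.Nat as ℕ using (ℕ; zero; suc; _<ᵇ_; _≤ᵇ_; _≡ᵇ_; _≤_)
import Data.Fin
open import Data.Fin using (Fin; toℕ; inject₁; fromℕ)
open import Data.Fin.Subset using (Subset; _∈_; ∣_∣)
open import Data.Integer as ℤ using (ℤ; +_)
open import Data.Rational as ℚ using (ℚ; 0ℚ; _/_)
open import Data.Product using (Σ; ∃; _×_)
open import Relation.Binary.PropositionalEquality using (_≡_; refl; cong; cong₂)
open import Data.Empty using (⊥)
open import Function.Definitions using (Injective)
open import Function.Bundles using (_↔_; Inverse)

record Graph (n : ℕ) : Set where
  field
    adj    : Fin n → Fin n → Bool
    sym    : ∀ x y → adj x y ≡ adj y x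
    irrefl : ∀ x → adj x x ≡ false
open Graph public

anyFin : ∀ {n} → (Fin n → Bool) → Bool
anyFin {zero}  f = false
anyFin {suc n} f = f Data.Fin.zero ∨ anyFin (λ i → f (Data.Fin.suc i))

reach : ∀ {n} → Graph n → ℕ → Fin n → Fin n → Bool
reach G zero    x y = toℕ x ≡ᵇ toℕ y
reach G (suc k) x y = anyFin (λ z → adj G x z ∧ reach G k z y)

-- shortest-path distance: least k (searching k = 0,1,…,n) with a walk
-- of length k from x to y (fallback value only for disconnected pairs)
distSearch : ∀ {n} → Graph n → Fin n → Fin n → ℕ → ℕ → ℕ
distSearch G x y zero     k = k
distSearch G x y (suc f) k =
  if reach G k x y then k else distSearch G x y f (suc k)

dist : ∀ {n} → Graph n → Fin n → Fin n → ℕ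
dist {n} G x y = distSearch G x y n 0

Connected : ∀ {n} → Graph n → Set
Connected G = ∀ x y → ∃ λ k → reach G k x y ≡ true

HasCycle : ∀ {n} → Graph n → Set
HasCycle {n} G =
  Σ ℕ λ k → Σ (Fin (suc (suc (suc k))) → Fin n) λ c →
    Injective _≡_ _≡_ c ×
    (∀ (i : Fin (suc (suc k))) → adj G (c (inject₁ i)) (c (Data.Fin.suc i)) ≡ true) ×
    adj G (c (fromℕ (suc (suc k)))) (c Data.Fin.zero) ≡ true

IsTree : ∀ {n} → Graph n → Set
IsTree G = Connected G × (HasCycle G → ⊥)

sumFin : ∀ {n} → (Fin n → ℚ) → ℚ
sumFin {zero}  f = 0ℚ
sumFin {suc n} f = f Data.Fin.zero ℚ.+ sumFin (λ i → f (Data.Fin.suc i))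

-- 1/d (value at 0 irrelevant: distinct vertices have distance ≥ 1)
inv : ℕ → ℚ
inv zero    = 0ℚ
inv (suc d) = + 1 / suc d

harary : ∀ {n} → Graph n → ℚ
harary G = sumFin λ x → sumFin λ y →
  if toℕ x <ᵇ toℕ y then inv (dist G x y) else 0ℚ

Independent : ∀ {n} → Graph n → Subset n → Set
Independent G S = ∀ x y → x ∈ S → y ∈ S → adj G x y ≡ false

IsIndependenceNumber : ∀ {n} → Graph n → ℕ → Set
IsIndependenceNumber G α =
  (∃ λ S → Independent G S × ∣ S ∣ ≡ α) ×
  (∀ S → Independent G S → ∣ S ∣ ≤ α)

_≅_ : ∀ {n} → Graph n → Graph n → Set
_≅_ {n} G H = Σ (Fin n ↔ Fin n) λ f →
  ∀ x y → adj G x y ≡ adj H (Inverse.to f x) (Inverse.to f y)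

-- Spur A_{n,m}: vertex 0 is the star centre, adjacent to 1,…,m;
-- vertex m+j (1 ≤ j ≤ n-m-1) is a pendent vertex attached to j.
spurEdge : ℕ → ℕ → ℕ → Bool
spurEdge m i j =
  ((i ≡ᵇ 0) ∧ (1 ≤ᵇ j) ∧ (j ≤ᵇ m)) ∨
  ((1 ≤ᵇ i) ∧ (i ≤ᵇ m) ∧ (j ≡ᵇ i ℕ.+ m))

spurAdj : ∀ {n} → ℕ → Fin n → Fin n → Bool
spurAdj m x y = not (toℕ x ≡ᵇ toℕ y) ∧
  (spurEdge m (toℕ x) (toℕ y) ∨ spurEdge m (toℕ y) (toℕ x))

private
  ∨-comm : ∀ a b → (a ∨ b) ≡ (b ∨ a)
  ∨-comm false false = refl
  ∨-comm false true  = refl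
  ∨-comm true  false = refl
  ∨-comm true  true  = refl

  ≡ᵇ-refl : ∀ i → (i ≡ᵇ i) ≡ true
  ≡ᵇ-refl zero    = refl
  ≡ᵇ-refl (suc i) = ≡ᵇ-refl i

  ≡ᵇ-sym : ∀ i j → (i ≡ᵇ j) ≡ (j ≡ᵇ i)
  ≡ᵇ-sym zero    zero    = refl
  ≡ᵇ-sym zero    (suc j) = refl
  ≡ᵇ-sym (suc i) zero    = refl
  ≡ᵇ-sym (suc i) (suc j) = ≡ᵇ-sym i j

spur : (n m : ℕ) → Graph n
spur n m = record
  { adj    = spurAdj m
  ; sym    = λ x y → cong₂ (λ a b → not a ∧ b) (≡ᵇ-sym (toℕ x) (toℕ y))
                       (∨-comm (spurEdge m (toℕ x) (toℕ y)) (spurEdge m (toℕ y) (toℕ x)))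
  ; irrefl = λ x → cong (λ a → not a ∧ (spurEdge m (toℕ x) (toℕ x) ∨ spurEdge m (toℕ x) (toℕ x))) (≡ᵇ-refl (toℕ x))
  }

{-# OPTIONS --safe #-}

-- Replace 1/d by γ(d)/24, where γ takes the values 24, 12, 8, 6, 6, 6, … at d = 1, 2, 3, …; this
-- is an upper bound, exact iff d ≤ 4.  The bound for the resulting sum follows by induction on n,
-- deleting the end v of a longest path.  Let u be the neighbour of v.
--  * If α drops to α − 1, then v contributes at most 24 + 12 (deg u − 1) + 8 (n − 1 − deg u), and
--    deg u ≤ α because the neighbours of u are independent; this is exactly the growth of the bound.
--  * If α does not change, then v has no twin leaf at u, so u has a single further neighbour w, and
--    v contributes 6 n + 2 deg w + 16 with deg w ≤ α, again exactly the growth of the bound.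
-- In the case of equality some vertex c (u or w) has degree α and every vertex is within distance 2
-- of c.  A neighbour w of c with two further neighbours could be exchanged for them in the
-- independent set N(c), so the tree is a spur centred at c.  Conversely, the value for a spur is
-- computed by deleting its vertices one by one, where both estimates are equalities.

module Submission where

open import Defs renaming (sym to adj-sym; irrefl to adj-irrefl)
open import Data.Bool using (Bool; true; false; _∧_; _∨_; if_then_else_; not)
import Data.Bool as Bool
open import Data.Bool.Properties using (T-≡; ¬-not)
open import Data.Empty using (⊥; ⊥-elim)
open import Data.Fin using (Fin; zero; suc; toℕ; fromℕ; fromℕ<; punchIn; punchOut)
open import Data.Fin.Properties using (_≟_; any?; all?; pigeonhole; injective⇒≤; toℕ-injective; toℕ<n; toℕ≤pred[n]; toℕ-inject₁; toℕ-fromℕ; toℕ-fromℕ<; punchInᵢ≢i; punchIn-injective; punchIn-punchOut; punchOut-injective)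
open import Data.Fin.Subset using (Subset; ∣_∣)
open import Data.Fin.Subset.Properties using (anySubset?)
open import Data.Nat using (ℕ; zero; suc; _≤_; _<_; _≤ᵇ_; _<ᵇ_; _≡ᵇ_; z≤n; s≤s)
import Data.Nat as ℕ
open import Data.Nat.Induction using (<-rec)
import Data.Nat.Properties as ℕ
open import Data.Nat.Tactic.RingSolver using (solve-∀)
open import Data.Product using (∃-syntax; _×_; _,_; proj₁; proj₂)
open import Data.Sum using (_⊎_; inj₁; inj₂)
open import Data.Vec using (lookup; tabulate; []; _∷_)
open import Data.Vec.Functional using (updateAt; insertAt)
open import Data.Vec.Functional.Properties using (updateAt-updates; updateAt-minimal; insertAt-lookup; insertAt-punchIn)
open import Data.Vec.Properties using (lookup∘tabulate; []=⇒lookup; lookup⇒[]=)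
open import Function using (_∘_; Equivalence; Injective; Inverse; _↔_; mk↔ₛ′)
open import Function.Construct.Identity using (↔-id)
open import Relation.Binary.PropositionalEquality
open import Relation.Nullary using (¬_; Dec; yes; no; contradiction; ¬?; _×-dec_; does)
open import Relation.Nullary.Decidable using (dec-true; dec-false; decidable-stable; _→-dec_)
open import Algebra.Properties.CommutativeMonoid.Sum ℕ.+-0-commutativeMonoid using (sum; sum-cong-≗; sum-remove; ∑-distrib-+; ∑-comm; sum-permute)
open import Algebra.Properties.Semiring.Sum ℕ.+-*-semiring using (*-distribˡ-sum)

-- Flattening the weight at distance 4 loses nothing for a connected spur, whose diameter is at most
-- 4, and it makes the second case exact: when `u` has only the neighbours `v` and `w`, every vertex
-- other than `v`, `u`, `w` and the neighbours of `w` is at distance at least 4 from `v` and weighs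
-- 6, so the degree of `w` alone determines the contribution. The price is that the weights cannot
-- tell 4 from larger distances. In the equality case the missing diameter bound is recovered from
-- the strictness of 1/d < 6/24 for d > 4.
--
-- A twin excludes an unchanged α: an independent set of that size avoiding `v` could be enlarged,
-- either by `v` itself or by trading `u` for both twins.
--
-- All estimates live in the natural numbers. Sums run over ordered pairs, so the factor 24 becomes
-- 48, and the negative terms of the bound, doubled to 18α + 44, are added to the other side instead
-- of being subtracted.

module Combinatorics where

  open import Data.Nat using (_+_; _*_; _∸_; _⊓_)
  open import Data.Nat.Properties hiding (_≟_)

  private variable
    n : ℕ

  -- Walks and distances

  true≢false : ∀ {b} → b ≡ true → b ≡ false → ⊥
  true≢false refl ()

  anyFin-intro : (f : Fin n → Bool) (x : Fin n) → f x ≡ true → anyFin f ≡ true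
  anyFin-intro f zero    p rewrite p = refl
  anyFin-intro f (suc x) p with f zero
  ... | true  = refl
  ... | false = anyFin-intro (f ∘ suc) x p

  anyFin-elim : (f : Fin n → Bool) → anyFin f ≡ true → ∃[ x ] f x ≡ true
  anyFin-elim {suc n} f p with f zero in eq
  ... | true  = zero , eq
  ... | false with anyFin-elim (f ∘ suc) p
  ...   | x , q = suc x , q

  ∧-true : ∀ {a b} → a ∧ b ≡ true → a ≡ true × b ≡ true
  ∧-true {true} p = refl , p

  ≡ᵇ-true : ∀ {i j} → (i ≡ᵇ j) ≡ true → i ≡ j
  ≡ᵇ-true {i} {j} p = ≡ᵇ⇒≡ i j (Equivalence.from T-≡ p)

  ≡ᵇ-diag : ∀ {i j} → i ≡ j → (i ≡ᵇ j) ≡ true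
  ≡ᵇ-diag {i} {j} p = Equivalence.to T-≡ (≡⇒≡ᵇ i j p)

  infix 4 _⊢_~_
  _⊢_~_ : Graph n → Fin n → Fin n → Set
  G ⊢ x ~ y = adj G x y ≡ true

  module _ {G : Graph n} where

    ~-sym : ∀ {x y} → G ⊢ x ~ y → G ⊢ y ~ x
    ~-sym {x} {y} p = trans (adj-sym G y x) p

    ~-irrefl : ∀ {x} → ¬ G ⊢ x ~ x
    ~-irrefl {x} p = true≢false p (adj-irrefl G x)

    ~⇒≢ : ∀ {x y} → G ⊢ x ~ y → x ≢ y
    ~⇒≢ p refl = ~-irrefl p

  infixr 5 _∷_
  data Walk (G : Graph n) : ℕ → Fin n → Fin n → Set where
    []  : ∀ {x} → Walk G 0 x x
    _∷_ : ∀ {k x z y} → G ⊢ x ~ z → Walk G k z y → Walk G (suc k) x y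

  module _ {G : Graph n} where

    reach⇒Walk : ∀ k {x y} → reach G k x y ≡ true → Walk G k x y
    reach⇒Walk zero {x} p = subst (Walk G 0 x) (toℕ-injective (≡ᵇ-true p)) []
    reach⇒Walk (suc k) {x} {y} p with anyFin-elim (λ z → adj G x z ∧ reach G k z y) p
    ... | z , q = proj₁ (∧-true q) ∷ reach⇒Walk k (proj₂ (∧-true q))

    Walk⇒reach : ∀ {k x y} → Walk G k x y → reach G k x y ≡ true
    Walk⇒reach ([] {x}) = ≡ᵇ-diag {toℕ x} refl
    Walk⇒reach (_∷_ {k} {x} {z} {y} e w) =
      anyFin-intro (λ v → adj G x v ∧ reach G k v y) z (cong₂ _∧_ e (Walk⇒reach w))

    connected-walk : Connected G → ∀ x y → ∃[ k ] Walk G k x y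
    connected-walk conn x y with conn x y
    ... | k , p = k , reach⇒Walk k p

    connected-from-walks : (∀ x y → ∃[ k ] Walk G k x y) → Connected G
    connected-from-walks h x y = proj₁ (h x y) , Walk⇒reach (proj₂ (h x y))

    infixr 5 _++ʷ_
    _++ʷ_ : ∀ {k l x y z} → Walk G k x y → Walk G l y z → Walk G (k + l) x z
    []      ++ʷ v = v
    (e ∷ w) ++ʷ v = e ∷ (w ++ʷ v)

    reverse : ∀ {k x y} → Walk G k x y → Walk G k y x
    reverse [] = []
    reverse {suc k} {x} {y} (e ∷ w) = subst (λ l → Walk G l y x) (+-comm k 1) (reverse w ++ʷ (~-sym {G = G} e ∷ []))

    vertexAt : ∀ {k x y} → Walk G k x y → Fin (suc k) → Fin n
    vertexAt {x = x} w       zero    = x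
    vertexAt         (e ∷ w) (suc i) = vertexAt w i

    prefix : ∀ {k x y} (w : Walk G k x y) i → Walk G (toℕ i) x (vertexAt w i)
    prefix w       zero    = []
    prefix (e ∷ w) (suc i) = e ∷ prefix w i

    suffix : ∀ {k x y} (w : Walk G k x y) i → Walk G (k ∸ toℕ i) (vertexAt w i) y
    suffix w       zero    = w
    suffix (e ∷ w) (suc i) = suffix w i

    -- A walk longer than the number of vertices repeats a vertex, and the detour between the two visits can be cut out.
    shorten : ∀ {k x y} → Walk G k x y → ∃[ l ] l ≤ n × Walk G l x y
    shorten {k} {x} {y} = <-rec (λ k → Walk G k x y → ∃[ l ] l ≤ n × Walk G l x y) step k
      where
      step : ∀ k → (∀ {j} → j < k → Walk G j x y → ∃[ l ] l ≤ n × Walk G l x y) →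
             Walk G k x y → ∃[ l ] l ≤ n × Walk G l x y
      step k rec w with k ≤? n
      ... | yes k≤n = k , k≤n , w
      ... | no  k≰n with pigeonhole (m≤n⇒m≤1+n (≰⇒> k≰n)) (vertexAt w)
      ...   | i , j , i<j , eq =
        rec shorter (prefix w i ++ʷ subst (λ v → Walk G (k ∸ toℕ j) v y) (sym eq) (suffix w j))
        where
        shorter : toℕ i + (k ∸ toℕ j) < k
        shorter = begin-strict
          toℕ i + (k ∸ toℕ j) <⟨ +-monoˡ-< (k ∸ toℕ j) i<j ⟩
          toℕ j + (k ∸ toℕ j) ≡⟨ m+[n∸m]≡n (toℕ≤pred[n] j) ⟩
          k                   ∎
          where open ≤-Reasoning

    distSearch-minimal : ∀ {x y k} f s → (∀ {j} → j < s → ¬ Walk G j x y) →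
                         Walk G k x y → distSearch G x y f s ≤ k
    distSearch-minimal zero s none w = ≮⇒≥ λ k<s → none k<s w
    distSearch-minimal {x} {y} (suc f) s none w with reach G s x y in eq
    ... | true  = ≮⇒≥ λ k<s → none k<s w
    ... | false = distSearch-minimal f (suc s) none′ w
      where
      none′ : ∀ {j} → j < suc s → ¬ Walk G j x y
      none′ {j} j<1+s v with m<1+n⇒m<n∨m≡n j<1+s
      ... | inj₁ j<s  = none j<s v
      ... | inj₂ refl = true≢false (Walk⇒reach v) eq

    -- When the fuel runs out, the fallback value `s` is itself the length of the given walk: `none`
    -- excludes a shorter one and `k ≤ s + f` a longer one. This is why `dist-walk` needs a walk of
    -- length at most `n`.
    distSearch-walk : ∀ {x y k} f s → (∀ {j} → j < s → ¬ Walk G j x y) → k ≤ s + f →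
                      Walk G k x y → Walk G (distSearch G x y f s) x y
    distSearch-walk {x} {y} {k} zero s none k≤ w =
      subst (λ l → Walk G l x y) (≤-antisym (subst (k ≤_) (+-identityʳ s) k≤) (≮⇒≥ λ k<s → none k<s w)) w
    distSearch-walk {x} {y} {k} (suc f) s none k≤ w with reach G s x y in eq
    ... | true  = reach⇒Walk s eq
    ... | false = distSearch-walk f (suc s) none′ (subst (k ≤_) (+-suc s f) k≤) w
      where
      none′ : ∀ {j} → j < suc s → ¬ Walk G j x y
      none′ {j} j<1+s v with m<1+n⇒m<n∨m≡n j<1+s
      ... | inj₁ j<s  = none j<s v
      ... | inj₂ refl = true≢false (Walk⇒reach v) eq

    dist-minimal : ∀ {x y k} → Walk G k x y → dist G x y ≤ k
    dist-minimal = distSearch-minimal n 0 λ ()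

    dist-walk : Connected G → ∀ x y → Walk G (dist G x y) x y
    dist-walk conn x y with shorten (proj₂ (connected-walk conn x y))
    ... | l , l≤n , w = distSearch-walk n 0 (λ ()) l≤n w

    dist-sym : Connected G → ∀ x y → dist G x y ≡ dist G y x
    dist-sym conn x y = ≤-antisym (dist-minimal (reverse (dist-walk conn y x)))
                                  (dist-minimal (reverse (dist-walk conn x y)))

    dist-self : ∀ x → dist G x x ≡ 0
    dist-self x = n≤0⇒n≡0 (dist-minimal [])

  -- The common tool for comparing distances in two graphs: deletion of a leaf and isomorphism both
  -- apply it in each direction.
  dist-≤-of-walks : ∀ {m} {G : Graph n} {H : Graph m} {x y x′ y′} → Connected H →
                    (∀ {k} → Walk H k x′ y′ → ∃[ l ] l ≤ k × Walk G l x y) → dist G x y ≤ dist H x′ y′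
  dist-≤-of-walks {x′ = x′} {y′} conn t with t (dist-walk conn x′ y′)
  ... | l , l≤ , w = ≤-trans (dist-minimal w) l≤

  -- The end of a longest path

  Acyclic : Graph n → Set
  Acyclic G = ¬ HasCycle G

  -- Only the values p 0, …, p l matter.
  record Path (G : Graph n) (l : ℕ) (p : ℕ → Fin n) : Set where
    field
      injective : ∀ {i j} → i ≤ l → j ≤ l → p i ≡ p j → i ≡ j
      linked    : ∀ {i} → i < l → G ⊢ (p i) ~ (p (suc i))
  open Path

  infixr 5 _◂_
  _◂_ : Fin n → (ℕ → Fin n) → ℕ → Fin n
  (z ◂ p) zero    = z
  (z ◂ p) (suc i) = p i

  module _ {G : Graph n} where

    Path-tail : ∀ {l p} → Path G (suc l) p → Path G l (p ∘ suc)
    Path-tail P .injective i≤l j≤l = suc-injective ∘ P .injective (s≤s i≤l) (s≤s j≤l)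
    Path-tail P .linked i<l        = P .linked (s≤s i<l)

    Path-cons : ∀ {l p z} → Path G l p → G ⊢ z ~ (p 0) → (∀ {i} → i ≤ l → z ≢ p i) → Path G (suc l) (z ◂ p)
    Path-cons P e fresh .injective {zero}  {zero}  _ _ _ = refl
    Path-cons P e fresh .injective {zero}  {suc j} _ (s≤s j≤l) q = contradiction q (fresh j≤l)
    Path-cons P e fresh .injective {suc i} {zero}  (s≤s i≤l) _ q = contradiction (sym q) (fresh i≤l)
    Path-cons P e fresh .injective {suc i} {suc j} (s≤s i≤l) (s≤s j≤l) q = cong suc (P .injective i≤l j≤l q)
    Path-cons P e fresh .linked {zero}  _         = e
    Path-cons P e fresh .linked {suc i} (s≤s i<l) = P .linked i<l

    Path-single : ∀ x → Path G 0 (λ _ → x)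
    Path-single x .injective z≤n z≤n _ = refl
    Path-single x .linked ()

    Path-bounded : ∀ {l p} → Path G l p → l < n
    Path-bounded {l} {p} P = injective⇒≤ {f = p ∘ toℕ} λ {i} {j} q →
      toℕ-injective (P .injective (toℕ≤pred[n] i) (toℕ≤pred[n] j) q)

    Path-cycle : ∀ {l p k} → Path G l p → suc (suc k) ≤ l → G ⊢ (p (suc (suc k))) ~ (p 0) → HasCycle G
    Path-cycle {l} {p} {k} P k≤l e = k , p ∘ toℕ ,
      (λ {i} {j} q → toℕ-injective
        (P .injective (≤-trans (toℕ≤pred[n] i) k≤l) (≤-trans (toℕ≤pred[n] j) k≤l) q)) ,
      (λ i → subst (λ t → G ⊢ (p t) ~ (p (suc (toℕ i)))) (sym (toℕ-inject₁ i))
        (P .linked (<-≤-trans (toℕ<n i) k≤l))) ,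
      subst (λ t → G ⊢ (p t) ~ (p 0)) (sym (toℕ-fromℕ (suc (suc k)))) e

    module _ (acyclic : Acyclic G) where

      -- Index 0 would be a loop, and an index of at least 2 closes a cycle. Triangles, squares and
      -- pentagons are refuted below by writing them as a path whose last vertex is adjacent to its
      -- first, which would force its index to be 1.
      neighbour-on-path : ∀ {l p z} → Path G l p → G ⊢ z ~ (p 0) →
                          ∀ {i} → i ≤ l → z ≡ p i → i ≡ 1
      neighbour-on-path P e {zero}        _   refl = contradiction e (~-irrefl {G = G})
      neighbour-on-path P e {suc zero}    _   _    = refl
      neighbour-on-path P e {suc (suc k)} i≤l refl = contradiction (Path-cycle P i≤l e) acyclic

      -- Acyclicity reduces the freshness of `z` to the single test against `p 1`.
      Path-extend : ∀ {l p z} → Path G (suc l) p → G ⊢ z ~ (p 0) → z ≢ p 1 → Path G (suc (suc l)) (z ◂ p)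
      Path-extend {l} {p} {z} P e z≢p₁ = Path-cons P e fresh
        where
        fresh : ∀ {i} → i ≤ suc l → z ≢ p i
        fresh i≤l q with neighbour-on-path P e i≤l q
        ... | refl = z≢p₁ q

      edge-path : ∀ {x y} → G ⊢ x ~ y → Path G 1 (x ◂ (λ _ → y))
      edge-path e = Path-cons (Path-single _) e λ _ → ~⇒≢ {G = G} e

      no-triangle : ∀ {x y z} → G ⊢ x ~ y → G ⊢ y ~ z → ¬ G ⊢ x ~ z
      no-triangle {x} {y} {z} xy yz xz with
        neighbour-on-path (Path-extend (edge-path yz) xy (~⇒≢ {G = G} xz)) (~-sym {G = G} xz) {2} ≤-refl refl
      ... | ()

      no-square : ∀ {a b x y} → a ≢ b → G ⊢ a ~ x → G ⊢ x ~ b → G ⊢ a ~ y → G ⊢ y ~ b → x ≡ y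
      no-square {a} {b} {x} {y} a≢b ax xb ay yb with x ≟ y
      ... | yes x≡y = x≡y
      ... | no  x≢y with neighbour-on-path path (~-sym {G = G} ay) {3} ≤-refl refl
        where
        path : Path G 3 (a ◂ x ◂ b ◂ (λ _ → y))
        path = Path-extend (Path-extend (edge-path (~-sym {G = G} yb)) xb x≢y) ax a≢b
      ...   | ()

  record Leaf (G : Graph n) (v u : Fin n) : Set where
    field
      attached : G ⊢ v ~ u
      only     : ∀ {x} → G ⊢ v ~ x → x ≡ u
  open Leaf

  -- The two shapes of the end of a longest path v, u, w, …
  data Tip (G : Graph n) : Set where
    twin : ∀ {v v′ u} → v ≢ v′ → Leaf G v u → Leaf G v′ u → Tip G
    leg  : ∀ {v u w} → v ≢ w → Leaf G v u → G ⊢ u ~ w → (∀ {x} → G ⊢ u ~ x → x ≡ v ⊎ x ≡ w) → Tip G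

  module _ {G : Graph n} where

    adj? : ∀ x y → Dec (G ⊢ x ~ y)
    adj? x y = adj G x y Bool.≟ true

    module _ (acyclic : Acyclic G) where

      -- Every non-terminal case replaces the current path by a longer one.
      longest : ∀ f {l p} → n ≤ f + l → Path G (suc (suc l)) p → Tip G
      longest zero    n≤l P = contradiction (Path-bounded P) (≤⇒≯ (m≤n⇒m≤1+n (m≤n⇒m≤1+n n≤l)))
      longest (suc f) {l} {p} n≤ P with any? (λ z → adj? (p 0) z ×-dec ¬? (z ≟ p 1))
      ... | yes (z , e , z≢p₁) = longest f (subst (n ≤_) (sym (+-suc f l)) n≤) (Path-extend acyclic P (~-sym {G = G} e) z≢p₁)
      ... | no  none with any? (λ z → adj? (p 1) z ×-dec (¬? (z ≟ p 0) ×-dec ¬? (z ≟ p 2)))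
      ...   | no none′ = leg {v = p 0} {p 1} {p 2} p₀≢p₂ leaf (P .linked (s≤s (s≤s z≤n))) other
        where
        p₀≢p₂ : p 0 ≢ p 2
        p₀≢p₂ q with P .injective z≤n (s≤s (s≤s z≤n)) q
        ... | ()
        leaf : Leaf G (p 0) (p 1)
        leaf .attached = P .linked (s≤s z≤n)
        leaf .only e   = decidable-stable (_ ≟ _) λ x≢ → none (_ , e , x≢)
        other : ∀ {x} → G ⊢ (p 1) ~ x → x ≡ p 0 ⊎ x ≡ p 2
        other {x} e with x ≟ p 0
        ... | yes q = inj₁ q
        ... | no  x≢ = inj₂ (decidable-stable (_ ≟ _) λ x≢′ → none′ (x , e , x≢ , x≢′))
      ...   | yes (z , e , z≢p₀ , z≢p₂) with any? (λ y → adj? z y ×-dec ¬? (y ≟ p 1))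
      ...     | yes (y , e′ , y≢p₁) =
        longest f (subst (n ≤_) (sym (+-suc f l)) n≤)
          (Path-extend acyclic (Path-extend acyclic (Path-tail P) (~-sym {G = G} e) z≢p₂) (~-sym {G = G} e′) y≢p₁)
      ...     | no none″ = twin {v = p 0} {z} {p 1} (z≢p₀ ∘ sym)
        (record { attached = P .linked (s≤s z≤n) ; only = λ e′ → decidable-stable (_ ≟ _) λ x≢ → none (_ , e′ , x≢) })
        (record { attached = ~-sym {G = G} e ; only = λ e′ → decidable-stable (_ ≟ _) λ x≢ → none″ (_ , e′ , x≢) })

    first-step : ∀ {k x y} → Walk G k x y → x ≢ y → ∃[ z ] G ⊢ x ~ z
    first-step []      x≢x = contradiction refl x≢x
    first-step (e ∷ w) _   = _ , e

    closed-walk : (P : Fin n → Set) → (∀ {x y} → P x → G ⊢ x ~ y → P y) →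
                  ∀ {k x y} → Walk G k x y → P x → P y
    closed-walk P step []      px = px
    closed-walk P step (e ∷ w) px = closed-walk P step w (step px e)

  -- Any path on three vertices starts the search. If neither `zero` nor its neighbour `y` has
  -- another neighbour, these two are closed under adjacency, and connectivity would make the
  -- vertices 1 and 2 both equal to `y`.
  tree-tip : {G : Graph (suc (suc (suc n)))} → IsTree G → Tip G
  tree-tip {n} {G} (conn , acyclic)
    with first-step (proj₂ (connected-walk conn zero (suc zero))) (λ ())
  ... | y , 0~y with any? (λ z → adj? {G = G} y z ×-dec ¬? (z ≟ zero))
  ...   | yes (z , y~z , z≢0) = longest acyclic _ (m≤m+n _ _) (Path-extend acyclic (edge-path acyclic y~z) 0~y (z≢0 ∘ sym))
  ...   | no none with any? (λ z → adj? {G = G} zero z ×-dec ¬? (z ≟ y))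
  ...     | yes (z , 0~z , z≢y) = longest acyclic _ (m≤m+n _ _) (Path-extend acyclic (edge-path acyclic 0~y) (~-sym {G = G} 0~z) z≢y)
  ...     | no none′ = ⊥-elim (three (reached (suc zero)) (reached (suc (suc zero))))
    where
    only-two : ∀ {x z} → x ≡ zero ⊎ x ≡ y → G ⊢ x ~ z → z ≡ zero ⊎ z ≡ y
    only-two {z = z} (inj₁ refl) e with z ≟ y
    ... | yes q = inj₂ q
    ... | no  q = contradiction (z , e , q) none′
    only-two {z = z} (inj₂ refl) e with z ≟ zero
    ... | yes q = inj₁ q
    ... | no  q = contradiction (z , e , q) none
    reached : ∀ z → z ≡ zero ⊎ z ≡ y
    reached z = closed-walk (λ x → x ≡ zero ⊎ x ≡ y) only-two (proj₂ (connected-walk conn zero z)) (inj₁ refl)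
    three : suc zero ≡ zero ⊎ suc zero ≡ y → suc (suc zero) ≡ zero ⊎ suc (suc zero) ≡ y → ⊥
    three (inj₁ ()) _
    three _ (inj₁ ())
    three (inj₂ p) (inj₂ q) with trans p (sym q)
    ... | ()

  -- Deleting a leaf

  delete : Graph (suc n) → Fin (suc n) → Graph n
  delete G v .adj x y        = adj G (punchIn v x) (punchIn v y)
  delete G v .adj-sym x y    = adj-sym G (punchIn v x) (punchIn v y)
  delete G v .adj-irrefl x   = adj-irrefl G (punchIn v x)

  delete-acyclic : {G : Graph (suc n)} → Acyclic G → ∀ v → Acyclic (delete G v)
  delete-acyclic acyclic v (k , c , inj , linked , closed) =
    acyclic (k , punchIn v ∘ c , inj ∘ punchIn-injective v _ _ , linked , closed)

  module _ {G : Graph (suc n)} where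

    lift : ∀ {v k x y} → Walk (delete G v) k x y → Walk G k (punchIn v x) (punchIn v y)
    lift []      = []
    lift (e ∷ w) = e ∷ lift w

    module _ {v u : Fin (suc n)} (leaf : Leaf G v u) where

      -- A walk can only visit the leaf v as u, v, u.
      restrict : ∀ {k a b} → Walk G k a b → ∀ {x y} → a ≡ punchIn v x → b ≡ punchIn v y →
                 ∃[ l ] l ≤ k × Walk (delete G v) l x y
      restrictᵛ : ∀ {k b} → Walk G k v b → ∀ {x y} → u ≡ punchIn v x → b ≡ punchIn v y →
                  ∃[ l ] l ≤ k × Walk (delete G v) l x y
      restrict [] {x} {y} p q with punchIn-injective v x y (trans (sym p) q)
      ... | refl = 0 , z≤n , []
      restrict (_∷_ {z = z} e w) {x} {y} p q with v ≟ z
      ... | yes refl with restrictᵛ w (trans (sym (leaf .only (~-sym {G = G} e))) p) q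
      ...   | l , l≤k , w′ = l , m≤n⇒m≤1+n l≤k , w′
      restrict (_∷_ {z = z} e w) {x} {y} p q | no v≢z with restrict w (sym (punchIn-punchOut v≢z)) q
      ... | l , l≤k , w′ = suc l , s≤s l≤k , (subst₂ (G ⊢_~_) p (sym (punchIn-punchOut v≢z)) e ∷ w′)
      restrictᵛ [] p q = contradiction (sym q) (punchInᵢ≢i v _)
      restrictᵛ (e ∷ w) p q with restrict w (trans (leaf .only e) p) q
      ... | l , l≤k , w′ = l , m≤n⇒m≤1+n l≤k , w′

      delete-connected : Connected G → Connected (delete G v)
      delete-connected conn = connected-from-walks walk
        where
        walk : ∀ x y → ∃[ k ] Walk (delete G v) k x y
        walk x y with restrict (proj₂ (connected-walk conn (punchIn v x) (punchIn v y))) refl refl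
        ... | l , _ , w = l , w

      delete-tree : IsTree G → IsTree (delete G v)
      delete-tree (conn , acyclic) = delete-connected conn , delete-acyclic {G = G} acyclic v

      dist-delete : Connected G → ∀ x y → dist (delete G v) x y ≡ dist G (punchIn v x) (punchIn v y)
      dist-delete conn x y = ≤-antisym
        (dist-≤-of-walks conn λ w → restrict w refl refl)
        (dist-≤-of-walks (delete-connected conn) λ {k} w → k , ≤-refl , lift w)

  -- Sums over vertices and squeezing

  ⟦_⟧ : Bool → ℕ
  ⟦ false ⟧ = 0
  ⟦ true  ⟧ = 1

  δ : Fin n → Fin n → ℕ
  δ x y = ⟦ does (x ≟ y) ⟧

  δ-diag : (x : Fin n) → δ x x ≡ 1
  δ-diag x = cong ⟦_⟧ (dec-true (x ≟ x) refl)

  δ-off : ∀ {x y : Fin n} → x ≢ y → δ x y ≡ 0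
  δ-off {x = x} {y} p = cong ⟦_⟧ (dec-false (x ≟ y) p)

  sum-const : ∀ n c → sum {n} (λ _ → c) ≡ n * c
  sum-const zero    c = refl
  sum-const (suc n) c = cong (c +_) (sum-const n c)

  sum-δ : (x : Fin n) → sum (δ x) ≡ 1
  sum-δ {suc n} x = begin
    sum (δ x)                          ≡⟨ sum-remove {i = x} (δ x) ⟩
    δ x x + sum (λ i → δ x (punchIn x i)) ≡⟨ cong₂ _+_ (δ-diag x) (sum-cong-≗ λ i → δ-off (punchInᵢ≢i x i ∘ sym)) ⟩
    1 + sum {n} (λ _ → 0)              ≡⟨ cong (1 +_) (trans (sum-const n 0) (*-zeroʳ n)) ⟩
    1                                  ∎
    where open ≡-Reasoning

  sum-+* : ∀ (f : Fin n → ℕ) b (g : Fin n → ℕ) → sum (λ x → f x + b * g x) ≡ sum f + b * sum g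
  sum-+* f b g = trans (∑-distrib-+ f (λ x → b * g x)) (cong (sum f +_) (sym (*-distribˡ-sum b g)))

  sum-+δ : ∀ (f : Fin n → ℕ) b x → sum (λ y → f y + b * δ x y) ≡ sum f + b
  sum-+δ f b x = trans (sum-+* f b (δ x)) (cong (sum f +_) (trans (cong (b *_) (sum-δ x)) (*-identityʳ b)))

  sum-mono : {f g : Fin n → ℕ} → (∀ x → f x ≤ g x) → sum f ≤ sum g
  sum-mono {zero}  h = z≤n
  sum-mono {suc n} h = +-mono-≤ (h zero) (sum-mono (h ∘ suc))

  +-squeezeˡ : ∀ {a b c d} → a ≤ c → b ≤ d → c + d ≤ a + b → a ≡ c
  +-squeezeˡ {a} {b} {c} {d} a≤c b≤d h =
    ≤-antisym a≤c (+-cancelʳ-≤ d c a (≤-trans h (+-monoʳ-≤ a b≤d)))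

  +-squeezeʳ : ∀ {a b c d} → a ≤ c → b ≤ d → c + d ≤ a + b → b ≡ d
  +-squeezeʳ {a} {b} {c} {d} a≤c b≤d h =
    +-squeezeˡ b≤d a≤c (subst₂ _≤_ (+-comm c d) (+-comm a b) h)

  -- Used to turn tightness of a summed estimate into information about each single vertex.
  sum-squeeze : {f g : Fin n → ℕ} → (∀ x → f x ≤ g x) → sum g ≤ sum f → ∀ x → f x ≡ g x
  sum-squeeze {suc n} h e zero    = +-squeezeˡ (h zero) (sum-mono (h ∘ suc)) e
  sum-squeeze {suc n} h e (suc x) =
    sum-squeeze (h ∘ suc) (≤-reflexive (sym (+-squeezeʳ (h zero) (sum-mono (h ∘ suc)) e))) x

  -- Degrees, weights and the contribution of a leaf

  degree : Graph n → Fin n → ℕ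
  degree G x = sum (λ y → ⟦ adj G x y ⟧)

  -- 24 times an upper bound for 1/d that is exact for 1 ≤ d ≤ 4.
  γ : ℕ → ℕ
  γ 0 = 0
  γ 1 = 24
  γ 2 = 12
  γ 3 = 8
  γ _ = 6

  transmission : Graph n → Fin n → ℕ
  transmission G x = sum (λ y → γ (dist G x y))

  -- Ordered pairs are summed, so for a connected graph this is at least 48 times the Harary index.
  total : Graph n → ℕ
  total G = sum (transmission G)

  total-delete : ∀ {G : Graph (suc n)} {v u} → Connected G → Leaf G v u →
                 total G ≡ total (delete G v) + 2 * transmission G v
  total-delete {n} {G} {v} conn leaf = begin
    total G
      ≡⟨ sum-remove {i = v} (transmission G) ⟩
    transmission G v + sum (λ x → transmission G (p x))
      ≡⟨ cong (transmission G v +_) (sum-cong-≗ λ x → sum-remove {i = v} (λ y → γ (dist G (p x) y))) ⟩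
    transmission G v + sum (λ x → γ (dist G (p x) v) + sum (λ y → γ (dist G (p x) (p y))))
      ≡⟨ cong (transmission G v +_) (∑-distrib-+ (λ x → γ (dist G (p x) v)) (λ x → sum (λ y → γ (dist G (p x) (p y))))) ⟩
    transmission G v + (sum (λ x → γ (dist G (p x) v)) + sum (λ x → sum (λ y → γ (dist G (p x) (p y)))))
      ≡⟨ cong (transmission G v +_) (cong₂ _+_ from-v (sum-cong-≗ λ x → sum-cong-≗ λ y →
           cong γ (sym (dist-delete leaf conn x y)))) ⟩
    transmission G v + (transmission G v + total (delete G v))
      ≡⟨ rearranged (transmission G v) (total (delete G v)) ⟩
    total (delete G v) + 2 * transmission G v ∎
    where
    open ≡-Reasoning
    p = punchIn v
    rearranged : ∀ s t → s + (s + t) ≡ t + 2 * s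
    rearranged = solve-∀
    -- The entry of `v` at itself is absent on the left, but `γ 0` is 0.
    from-v : sum (λ x → γ (dist G (p x) v)) ≡ transmission G v
    from-v = begin
      sum (λ x → γ (dist G (p x) v))                   ≡⟨ sum-cong-≗ (λ x → cong γ (dist-sym conn (p x) v)) ⟩
      sum (λ x → γ (dist G v (p x)))                   ≡⟨ cong (λ d → γ d + sum (λ x → γ (dist G v (p x)))) (dist-self {G = G} v) ⟨
      γ (dist G v v) + sum (λ x → γ (dist G v (p x)))  ≡⟨ sum-remove {i = v} (λ y → γ (dist G v y)) ⟨
      transmission G v                                 ∎

  Within : Graph n → ℕ → Fin n → Fin n → Set
  Within G r x y = ∃[ k ] k ≤ r × Walk G k x y

  nonadj : ∀ {G : Graph n} {x y} → ¬ G ⊢ x ~ y → ⟦ adj G x y ⟧ ≡ 0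
  nonadj h = cong ⟦_⟧ (¬-not h)

  module _ {G : Graph n} {v u : Fin n} (leaf : Leaf G v u) where

    private
      u~v : G ⊢ u ~ v
      u~v = ~-sym {G = G} (leaf .attached)

    leaf-walk : ∀ {k x} → Walk G (suc k) v x → Walk G k u x
    leaf-walk (e ∷ w) rewrite leaf .only e = w

    -- Both sides are 12 at `v`, 24 at `u`, 12 at the other neighbours of `u` and 8 at distance 3.
    -- The term at `v` compensates for `v` being counted among the neighbours of `u`. The distance
    -- enters as a minimal walk length, so that the walk can be matched on.
    near-exact : ∀ {d x} → Walk G d v x → (∀ {k} → Walk G k v x → d ≤ k) → d ≤ 3 →
                 γ d + 12 * δ v x ≡ 8 + 4 * ⟦ adj G u x ⟧ + 16 * δ u x
    near-exact [] min _
      rewrite δ-diag v | u~v | δ-off (~⇒≢ {G = G} u~v) = refl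
    near-exact (e ∷ []) min _
      rewrite leaf .only e | δ-diag u | δ-off (~⇒≢ {G = G} (leaf .attached)) | adj-irrefl G u = refl
    near-exact {x = x} w@(_ ∷ _ ∷ []) min _ with leaf-walk w
    ... | u~x ∷ [] rewrite u~x | δ-off (~⇒≢ {G = G} u~x) | δ-off {x = v} {x} (λ { refl → contradiction (min []) λ () }) = refl
    near-exact {x = x} w@(_ ∷ _ ∷ _ ∷ []) min _
      rewrite δ-off {x = v} {x} (λ { refl → contradiction (min []) λ () })
            | δ-off {x = u} {x} (λ { refl → contradiction (min (leaf .attached ∷ [])) λ { (s≤s ()) } })
            | nonadj {G = G} {u} {x} (λ u~x → contradiction (min (leaf .attached ∷ u~x ∷ [])) λ { (s≤s (s≤s ())) }) = refl
    near-exact (_ ∷ _ ∷ _ ∷ _ ∷ _) min (s≤s (s≤s (s≤s ())))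

    -- From distance 4 on the left side is 6 while the right side is at least 8. This gap is what
    -- lets a tight sum bound the distances from `v`.
    far-strict : ∀ {d x} → (∀ {k} → Walk G k v x → d ≤ k) → 4 ≤ d →
                 γ d + 12 * δ v x < 8 + 4 * ⟦ adj G u x ⟧ + 16 * δ u x
    far-strict {suc (suc (suc (suc d)))} {x} min _
      rewrite δ-off {x = v} {x} (λ { refl → contradiction (min []) λ () }) = m≤n⇒m≤1+n (m≤m+n 7 _)
    far-strict {1} min (s≤s ())
    far-strict {2} min (s≤s (s≤s ()))
    far-strict {3} min (s≤s (s≤s (s≤s ())))

    -- Both sides are 6 at `v`, 24 at `u`, 12 at `w`, 8 at the other neighbours of `w` and 6
    -- elsewhere. A shortest walk from `v` to any further vertex passes through `u` and `w`, and `γ`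
    -- is constant from 4 on, so equality holds at every distance.
    leg-exact : ∀ {w d x} → v ≢ w → G ⊢ u ~ w → (∀ {x} → G ⊢ u ~ x → x ≡ v ⊎ x ≡ w) →
                Walk G d v x → (∀ {k} → Walk G k v x → d ≤ k) →
                γ d + 6 * δ v x ≡ 6 + 2 * ⟦ adj G w x ⟧ + 6 * δ w x + 16 * δ u x
    leg-exact {w} v≢w u~w two [] min
      rewrite δ-diag v | δ-off (v≢w ∘ sym) | δ-off (~⇒≢ {G = G} u~v)
            | nonadj {G = G} {w} {v} (λ w~v → ~⇒≢ {G = G} u~w (sym (leaf .only (~-sym {G = G} w~v)))) = refl
    leg-exact {w} v≢w u~w two (e ∷ []) min
      rewrite leaf .only e | δ-diag u | δ-off (~⇒≢ {G = G} (leaf .attached))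
            | ~-sym {G = G} u~w | δ-off (~⇒≢ {G = G} (~-sym {G = G} u~w)) = refl
    leg-exact {w} v≢w u~w two p@(_ ∷ _ ∷ []) min with leaf-walk p
    ... | u~x ∷ [] with two u~x
    ...   | inj₁ refl = contradiction (min []) λ ()
    ...   | inj₂ refl rewrite δ-off v≢w | δ-off (~⇒≢ {G = G} u~w) | δ-diag w | adj-irrefl G w = refl
    leg-exact {w} {x = x} v≢w u~w two p@(_ ∷ _ ∷ _ ∷ []) min with leaf-walk p
    ... | u~z ∷ z~x ∷ [] with two u~z
    ...   | inj₁ refl = contradiction (min (z~x ∷ [])) λ { (s≤s ()) }
    ...   | inj₂ refl rewrite z~x | δ-off (~⇒≢ {G = G} z~x)
            | δ-off {x = v} {x} (λ { refl → contradiction (min []) λ () })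
            | δ-off {x = u} {x} (λ { refl → contradiction (min (leaf .attached ∷ [])) λ { (s≤s ()) } }) = refl
    leg-exact {w} {x = x} v≢w u~w two p@(_ ∷ _ ∷ _ ∷ _ ∷ q) min
      rewrite δ-off {x = v} {x} (λ { refl → contradiction (min []) λ () })
            | δ-off {x = u} {x} (λ { refl → contradiction (min (leaf .attached ∷ [])) λ { (s≤s ()) } })
            | δ-off {x = w} {x} (λ { refl → contradiction (min (leaf .attached ∷ u~w ∷ [])) λ { (s≤s (s≤s ())) } })
            | nonadj {G = G} {w} {x} (λ w~x → contradiction (min (leaf .attached ∷ u~w ∷ w~x ∷ [])) λ { (s≤s (s≤s (s≤s ()))) }) = refl

    module _ (conn : Connected G) where

      near-≤ : ∀ x → γ (dist G v x) + 12 * δ v x ≤ 8 + 4 * ⟦ adj G u x ⟧ + 16 * δ u x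
      near-≤ x with dist G v x ≤? 3
      ... | yes d≤3 = ≤-reflexive (near-exact (dist-walk conn v x) dist-minimal d≤3)
      ... | no  d≰3 = <⇒≤ (far-strict {x = x} dist-minimal (≰⇒> d≰3))

      private
        near-lhs : sum (λ x → γ (dist G v x) + 12 * δ v x) ≡ transmission G v + 12
        near-lhs = sum-+δ (λ x → γ (dist G v x)) 12 v

        near-rhs : sum (λ x → 8 + 4 * ⟦ adj G u x ⟧ + 16 * δ u x) ≡ n * 8 + 4 * degree G u + 16
        near-rhs = trans (sum-+δ (λ x → 8 + 4 * ⟦ adj G u x ⟧) 16 u) (cong (_+ 16)
          (trans (sum-+* (λ _ → 8) 4 (λ x → ⟦ adj G u x ⟧)) (cong (_+ 4 * degree G u) (sum-const n 8))))

      leaf-transmission-≤ : transmission G v + 12 ≤ n * 8 + 4 * degree G u + 16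
      leaf-transmission-≤ = subst₂ _≤_ near-lhs near-rhs (sum-mono near-≤)

      leaf-transmission-exact : (∀ x → Within G 2 u x) →
                                transmission G v + 12 ≡ n * 8 + 4 * degree G u + 16
      leaf-transmission-exact within = trans (sym near-lhs) (trans (sum-cong-≗ exact) near-rhs)
        where
        exact : ∀ x → γ (dist G v x) + 12 * δ v x ≡ 8 + 4 * ⟦ adj G u x ⟧ + 16 * δ u x
        exact x with within x
        ... | k , k≤2 , w = near-exact (dist-walk conn v x) dist-minimal
                              (≤-trans (dist-minimal (leaf .attached ∷ w)) (s≤s k≤2))

      -- Tightness makes every vertex attain its estimate, so none is at distance 4 or more from
      -- `v`. Dropping the edge from `v` to `u` shortens the walk by one; `v` itself is reached from
      -- `u` directly.
      leaf-transmission-extremal : n * 8 + 4 * degree G u + 16 ≤ transmission G v + 12 →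
                                   ∀ x → Within G 2 u x
      leaf-transmission-extremal h x with dist G v x ≤? 3
      ... | no  d≰3 = contradiction (sum-squeeze near-≤ (subst₂ _≤_ (sym near-rhs) (sym near-lhs) h) x)
                        (<⇒≢ (far-strict {x = x} dist-minimal (≰⇒> d≰3)))
      ... | yes d≤3 with dist G v x | dist-walk conn v x
      ...   | zero  | []          = 1 , s≤s z≤n , u~v ∷ []
      ...   | suc d | w           = d , ≤-pred d≤3 , leaf-walk w

      leg-transmission : ∀ {w} → v ≢ w → G ⊢ u ~ w → (∀ {x} → G ⊢ u ~ x → x ≡ v ⊎ x ≡ w) →
                         transmission G v + 6 ≡ n * 6 + 2 * degree G w + 22
      leg-transmission {w} v≢w u~w two = begin
        transmission G v + 6
          ≡⟨ sum-+δ (λ x → γ (dist G v x)) 6 v ⟨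
        sum (λ x → γ (dist G v x) + 6 * δ v x)
          ≡⟨ sum-cong-≗ (λ x → leg-exact v≢w u~w two (dist-walk conn v x) dist-minimal) ⟩
        sum (λ x → 6 + 2 * ⟦ adj G w x ⟧ + 6 * δ w x + 16 * δ u x)
          ≡⟨ sum-+δ (λ x → 6 + 2 * ⟦ adj G w x ⟧ + 6 * δ w x) 16 u ⟩
        sum (λ x → 6 + 2 * ⟦ adj G w x ⟧ + 6 * δ w x) + 16
          ≡⟨ cong (_+ 16) (sum-+δ (λ x → 6 + 2 * ⟦ adj G w x ⟧) 6 w) ⟩
        sum (λ x → 6 + 2 * ⟦ adj G w x ⟧) + 6 + 16
          ≡⟨ +-assoc _ 6 16 ⟩
        sum (λ x → 6 + 2 * ⟦ adj G w x ⟧) + 22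
          ≡⟨ cong (_+ 22) (trans (sum-+* (λ _ → 6) 2 (λ x → ⟦ adj G w x ⟧)) (cong (_+ 2 * degree G w) (sum-const n 6))) ⟩
        n * 6 + 2 * degree G w + 22 ∎
        where open ≡-Reasoning

  -- Independent sets

  -- Vertex sets are Boolean functions here, so that a neighbourhood is `adj G x` itself and its
  -- `size` is `degree G x` by definition.
  Stable : Graph n → (Fin n → Bool) → Set
  Stable G f = ∀ x y → f x ≡ true → f y ≡ true → adj G x y ≡ false

  size : (Fin n → Bool) → ℕ
  size f = sum (λ x → ⟦ f x ⟧)

  IsStabilityNumber : Graph n → ℕ → Set
  IsStabilityNumber G α = (∃[ f ] Stable G f × size f ≡ α) × (∀ f → Stable G f → size f ≤ α)

  ∣∣≡size : (S : Subset n) → ∣ S ∣ ≡ size (lookup S)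
  ∣∣≡size []          = refl
  ∣∣≡size (true  ∷ S) = cong suc (∣∣≡size S)
  ∣∣≡size (false ∷ S) = ∣∣≡size S

  size-tabulate : (f : Fin n → Bool) → size (lookup (tabulate f)) ≡ size f
  size-tabulate f = sum-cong-≗ (λ x → cong ⟦_⟧ (lookup∘tabulate f x))

  stable-tabulate : ∀ {G : Graph n} {f} → Stable G f → Stable G (lookup (tabulate f))
  stable-tabulate {f = f} h x y p q =
    h x y (trans (sym (lookup∘tabulate f x)) p) (trans (sym (lookup∘tabulate f y)) q)

  independence⇒stability : ∀ {G : Graph n} {α} → IsIndependenceNumber G α → IsStabilityNumber G α
  independence⇒stability {G = G} ((S , ind , ∣S∣≡α) , max) =
    (lookup S , (λ x y p q → ind x y (lookup⇒[]= x S p) (lookup⇒[]= y S q)) , trans (sym (∣∣≡size S)) ∣S∣≡α) ,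
    λ f h → subst (_≤ _) (trans (∣∣≡size (tabulate f)) (size-tabulate f))
              (max (tabulate f) λ x y p q → stable-tabulate {G = G} h x y ([]=⇒lookup p) ([]=⇒lookup q))

  infixl 6 _[_≔_]
  _[_≔_] : (Fin n → Bool) → Fin n → Bool → Fin n → Bool
  f [ i ≔ b ] = updateAt f i (λ _ → b)

  size-update : ∀ (f : Fin n → Bool) i b → size (f [ i ≔ b ]) + ⟦ f i ⟧ ≡ size f + ⟦ b ⟧
  size-update f zero b = swapped ⟦ b ⟧ (size (f ∘ suc)) ⟦ f zero ⟧
    where
    swapped : ∀ x s y → x + s + y ≡ y + s + x
    swapped = solve-∀
  size-update f (suc i) b = begin
    ⟦ f zero ⟧ + size (f ∘ suc [ i ≔ b ]) + ⟦ f (suc i) ⟧   ≡⟨ +-assoc ⟦ f zero ⟧ _ _ ⟩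
    ⟦ f zero ⟧ + (size (f ∘ suc [ i ≔ b ]) + ⟦ f (suc i) ⟧) ≡⟨ cong (⟦ f zero ⟧ +_) (size-update (f ∘ suc) i b) ⟩
    ⟦ f zero ⟧ + (size (f ∘ suc) + ⟦ b ⟧)                   ≡⟨ +-assoc ⟦ f zero ⟧ _ _ ⟨
    size f + ⟦ b ⟧                                          ∎
    where open ≡-Reasoning

  size-insert : ∀ (f : Fin n → Bool) i → f i ≡ false → size (f [ i ≔ true ]) ≡ suc (size f)
  size-insert f i p = begin
    size (f [ i ≔ true ])            ≡⟨ +-identityʳ _ ⟨
    size (f [ i ≔ true ]) + 0        ≡⟨ cong (λ b → size (f [ i ≔ true ]) + ⟦ b ⟧) p ⟨
    size (f [ i ≔ true ]) + ⟦ f i ⟧  ≡⟨ size-update f i true ⟩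
    size f + 1                       ≡⟨ +-comm _ 1 ⟩
    suc (size f)                     ∎
    where open ≡-Reasoning

  size-erase : ∀ (f : Fin n → Bool) i → f i ≡ true → suc (size (f [ i ≔ false ])) ≡ size f
  size-erase f i p = begin
    suc (size (f [ i ≔ false ]))      ≡⟨ +-comm 1 _ ⟩
    size (f [ i ≔ false ]) + 1        ≡⟨ cong (λ b → size (f [ i ≔ false ]) + ⟦ b ⟧) p ⟨
    size (f [ i ≔ false ]) + ⟦ f i ⟧  ≡⟨ size-update f i false ⟩
    size f + 0                        ≡⟨ +-identityʳ _ ⟩
    size f                            ∎
    where open ≡-Reasoning

  erase-⊆ : ∀ {f : Fin n → Bool} {i x} → (f [ i ≔ false ]) x ≡ true → f x ≡ true
  erase-⊆ {f = f} {i} {x} p with x ≟ i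
  ... | yes refl = contradiction (updateAt-updates x f) (true≢false p)
  ... | no x≢i   = trans (sym (updateAt-minimal x i f x≢i)) p

  module _ {G : Graph n} where

    stable-insert : ∀ {f i} → Stable G f → (∀ {x} → G ⊢ i ~ x → f x ≡ false) → Stable G (f [ i ≔ true ])
    stable-insert {f} {i} h free x y p q with x ≟ i | y ≟ i
    ... | yes refl | yes refl = adj-irrefl G x
    ... | yes refl | no y≢i = ¬-not λ e → true≢false (trans (sym (updateAt-minimal y i f y≢i)) q) (free e)
    ... | no x≢i | yes refl = ¬-not λ e → true≢false (trans (sym (updateAt-minimal x i f x≢i)) p) (free (~-sym {G = G} e))
    ... | no x≢i | no y≢i = h x y (trans (sym (updateAt-minimal x i f x≢i)) p) (trans (sym (updateAt-minimal y i f y≢i)) q)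

    stable-erase : ∀ {f i} → Stable G f → Stable G (f [ i ≔ false ])
    stable-erase {f} h x y p q = h x y (erase-⊆ {f = f} p) (erase-⊆ {f = f} q)

    neighbours-stable : Acyclic G → ∀ x → Stable G (adj G x)
    neighbours-stable acyclic x y z p q = ¬-not λ e → no-triangle {G = G} acyclic p e q

    degree-≤ : Acyclic G → ∀ {α} → IsStabilityNumber G α → ∀ x → degree G x ≤ α
    degree-≤ acyclic (_ , max) x = max (adj G x) (neighbours-stable acyclic x)

    -- If `u` is outside the set, `v` can be added. If `u` is inside, then `v′` is not, and `u` can
    -- be traded for both leaves.
    twin-enlarge : ∀ {v v′ u f} → v ≢ v′ → Leaf G v u → Leaf G v′ u → Stable G f → f v ≡ false →
                   ∃[ g ] Stable G g × size g ≡ suc (size f)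
    twin-enlarge {v} {v′} {u} {f} v≢v′ leaf leaf′ h v∉ with f u in eq
    ... | false = f [ v ≔ true ] ,
                  stable-insert h (λ e → trans (cong f (leaf .only e)) eq) ,
                  size-insert f v v∉
    ... | true  = f″ [ v ≔ true ] ,
                  stable-insert (stable-insert (stable-erase h) free′) free ,
                  trans (size-insert f″ v v∉″) (cong suc (trans (size-insert f′ v′ v′∉) (size-erase f u eq)))
      where
      f′ = f [ u ≔ false ]
      f″ = f′ [ v′ ≔ true ]
      v≢u : v ≢ u
      v≢u = ~⇒≢ {G = G} (leaf .attached)
      v′≢u : v′ ≢ u
      v′≢u = ~⇒≢ {G = G} (leaf′ .attached)
      v′∉ : f′ v′ ≡ false
      v′∉ = trans (updateAt-minimal v′ u f v′≢u) (¬-not λ p → true≢false (leaf′ .attached) (h v′ u p eq))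
      v∉″ : f″ v ≡ false
      v∉″ = trans (updateAt-minimal v v′ f′ v≢v′) (trans (updateAt-minimal v u f v≢u) v∉)
      free′ : ∀ {x} → G ⊢ v′ ~ x → f′ x ≡ false
      free′ e = trans (cong f′ (leaf′ .only e)) (updateAt-updates u f)
      free : ∀ {x} → G ⊢ v ~ x → f″ x ≡ false
      free e = trans (cong f″ (leaf .only e)) (trans (updateAt-minimal u v′ f′ (v′≢u ∘ sym)) (updateAt-updates u f))

    stable? : ∀ f → Dec (Stable G f)
    stable? f = all? λ x → all? λ y → (f x Bool.≟ true) →-dec ((f y Bool.≟ true) →-dec (adj G x y Bool.≟ false))

    stable-of-size? : ∀ s → Dec (∃[ f ] Stable G f × size f ≡ s)
    stable-of-size? s with anySubset? (λ S → stable? (lookup S) ×-dec (size (lookup S) Data.Nat.≟ s))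
    ... | yes (S , h , e) = yes (lookup S , h , e)
    ... | no none = no λ (f , h , e) →
      none (tabulate f , stable-tabulate {G = G} h , trans (size-tabulate f) e)

  module _ {G : Graph (suc n)} where

    extend-stable : ∀ {f} v → Stable (delete G v) f →
                    ∃[ g ] Stable G g × g v ≡ false × size g ≡ size f
    extend-stable {f} v h = g , stable , insertAt-lookup f v false , sized
      where
      g = insertAt f v false
      stable : Stable G g
      stable x y p q with v ≟ x | v ≟ y
      ... | yes refl | _ = contradiction (insertAt-lookup f v false) (true≢false p)
      ... | no _ | yes refl = contradiction (insertAt-lookup f v false) (true≢false q)
      ... | no v≢x | no v≢y = subst₂ (λ a b → adj G a b ≡ false) (punchIn-punchOut v≢x) (punchIn-punchOut v≢y)
        (h (punchOut v≢x) (punchOut v≢y) (below v≢x p) (below v≢y q))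
        where
        below : ∀ {z} (v≢z : v ≢ z) → g z ≡ true → f (punchOut v≢z) ≡ true
        below v≢z r = trans (sym (insertAt-punchIn f v false (punchOut v≢z))) (trans (cong g (punchIn-punchOut v≢z)) r)
      sized : size g ≡ size f
      sized = trans (sum-remove {i = v} (λ x → ⟦ g x ⟧)) (cong₂ _+_ (cong ⟦_⟧ (insertAt-lookup f v false))
        (sum-cong-≗ λ x → cong ⟦_⟧ (insertAt-punchIn f v false x)))

    delete-≤ : ∀ {α} → IsStabilityNumber G α → ∀ v f → Stable (delete G v) f → size f ≤ α
    delete-≤ (_ , max) v f h with extend-stable v h
    ... | g , stable , _ , eq = subst (_≤ _) eq (max g stable)

    -- Exhaustive search decides whether a stable set of size α survives. If none does, a maximum
    -- stable set must contain `v`, since otherwise its restriction would survive; without `v` it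
    -- has α - 1 members, and every stable set of the smaller graph has fewer than α.
    delete-stability : ∀ {α} → IsStabilityNumber G α → ∀ v →
      IsStabilityNumber (delete G v) α ⊎ ∃[ β ] α ≡ suc β × IsStabilityNumber (delete G v) β
    delete-stability {α} num@((f , h , refl) , max) v with stable-of-size? {G = delete G v} α
    ... | yes found = inj₁ (found , delete-≤ num v)
    ... | no  none  = inj₂ (β , split , (restricted , restricted-stable , refl) , λ g s →
        ≤-pred (subst (size g <_) split (≤∧≢⇒< (delete-≤ num v g s) λ e → none (g , s , e))))
      where
      restricted = f ∘ punchIn v
      restricted-stable : Stable (delete G v) restricted
      restricted-stable x y = h (punchIn v x) (punchIn v y)
      β = size restricted
      split : size f ≡ suc β
      split with f v | sum-remove {i = v} (λ x → ⟦ f x ⟧)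
      ... | true  | e = e
      ... | false | e = contradiction (restricted , restricted-stable , sym e) none

  -- The upper bound

  -- 48 times the stated bound, without its negative terms: 9α + 22 doubles to 18α + 44, which is
  -- always found beside `total`.
  bound : ℕ → ℕ → ℕ
  bound n α = 2 * (3 * n * n + 2 * α * n + α * α + 19 * n)

  Centred : Graph n → ℕ → Set
  Centred G α = ∃[ c ] degree G c ≡ α × (∀ x → Within G 2 c x)

  -- The equality half assumes diameter at most 4 because `γ` does not separate the distances from 4
  -- on.
  Extremal : Graph n → ℕ → Set
  Extremal {n} G α = total G + (18 * α + 44) ≤ bound n α ×
    (bound n α ≤ total G + (18 * α + 44) → (∀ x y → dist G x y ≤ 4) → Centred G α)

  -- Here `a` and `A` stand for the value and the bound of the smaller tree, `s` for the shifted
  -- contribution of the leaf, and `d` for the degree that controls it. A tight sum forces the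
  -- contribution to its maximum.
  +-squeeze-scaled : ∀ {a A s K d α} c → a ≤ A → s ≤ K + c * d → d ≤ α → A + 2 * (K + c * α) ≤ a + 2 * s →
                     K + c * α ≡ s
  +-squeeze-scaled {a} {A} {s} {K} {d} {α} c a≤A s≤ d≤α h =
    sym (*-cancelˡ-≡ s (K + c * α) 2 (+-squeezeʳ a≤A (*-monoʳ-≤ 2 (≤-trans s≤ (+-monoʳ-≤ K (*-monoʳ-≤ c d≤α)))) h))

  extremal-edge : ∀ {G : Graph 2} {α} → IsTree G → IsStabilityNumber G α → Extremal G α
  extremal-edge {G} {α} tree@(conn , acyclic) num@((f , stable , size≡α) , _)
    with first-step (proj₂ (connected-walk conn zero (suc zero))) (λ ())
  ... | zero , 0~0 = contradiction 0~0 (~-irrefl {G = G})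
  ... | suc zero , 0~1 = subst (λ a → Extremal G a) (sym α≡1)
          -- 62 is 18 · 1 + 44, and 48 + 62 = 110 is `bound 2 1`.
          (≤-reflexive (cong (_+ 62) total≡48) , λ _ _ → zero , degree≡1 , within)
    where
    1~0 = ~-sym {G = G} 0~1
    degree≡1 : degree G zero ≡ 1
    degree≡1 rewrite adj-irrefl G zero | 0~1 = refl
    dist≡1 : ∀ {x y} → x ≢ y → G ⊢ x ~ y → dist G x y ≡ 1
    dist≡1 {x} {y} x≢y e with dist G x y | dist-walk conn x y | dist-minimal {G = G} (e ∷ [])
    ... | zero        | []    | _       = contradiction refl x≢y
    ... | suc zero    | _     | _       = refl
    ... | suc (suc _) | _     | s≤s ()
    total≡48 : total G ≡ 48
    total≡48 rewrite dist-self {G = G} zero | dist-self {G = G} (suc zero)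
                   | dist≡1 (λ ()) 0~1 | dist≡1 (λ ()) 1~0 = refl
    size≤1 : size f ≤ 1
    size≤1 with f zero in p | f (suc zero) in q
    ... | false | false = z≤n
    ... | false | true  = ≤-refl
    ... | true  | false = ≤-refl
    ... | true  | true  = contradiction (stable zero (suc zero) p q) (true≢false 0~1)
    α≡1 : α ≡ 1
    α≡1 = ≤-antisym (subst (_≤ 1) size≡α size≤1) (subst (_≤ α) degree≡1 (degree-≤ {G = G} acyclic num zero))
    within : ∀ x → Within G 2 zero x
    within zero       = 0 , z≤n , []
    within (suc zero) = 1 , s≤s z≤n , 0~1 ∷ []

  -- With α and n both one larger, the bound grows by exactly the largest possible contribution of the leaf v.
  extremal-near : ∀ {G : Graph (suc n)} {v u β} → IsTree G → Leaf G v u → IsStabilityNumber G (suc β) →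
                  Extremal (delete G v) β → Extremal G (suc β)
  extremal-near {n} {G} {v} {u} {β} (conn , acyclic) leaf num (ih , _) =
    -- 24 is twice the 12 by which `leaf-transmission-≤` shifts the contribution; the 18 on the
    -- later lines comes from α growing by one.
    +-cancelʳ-≤ 24 _ _ (begin
      total G + (18 * suc β + 44) + 24                                 ≡⟨ split ⟩
      total G′ + (18 * β + 44) + 2 * (t + 12) + 18                     ≤⟨ +-monoˡ-≤ 18 (+-mono-≤ ih (*-monoʳ-≤ 2 t≤)) ⟩
      bound n β + 2 * (K + 4 * suc β) + 18                             ≡⟨ grow n β ⟨
      bound (suc n) (suc β) + 24                                       ∎) ,
    λ tight _ → u , degree≡ tight , leaf-transmission-extremal leaf conn (≤-reflexive (begin-equality
      suc n * 8 + 4 * degree G u + 16  ≡⟨ cong (λ d → suc n * 8 + 4 * d + 16) (degree≡ tight) ⟩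
      suc n * 8 + 4 * suc β + 16       ≡⟨ regroup (suc n * 8) (4 * suc β) 16 ⟩
      K + 4 * suc β                    ≡⟨ t≡ tight ⟩
      t + 12                           ∎))
    where
    open ≤-Reasoning
    G′ = delete G v
    t = transmission G v
    K = suc n * 8 + 16
    grow : ∀ n β → 2 * (3 * suc n * suc n + 2 * suc β * suc n + suc β * suc β + 19 * suc n) + 24 ≡
                   2 * (3 * n * n + 2 * β * n + β * β + 19 * n) + 2 * (suc n * 8 + 16 + 4 * suc β) + 18
    grow = solve-∀
    regroup : ∀ a b c → a + b + c ≡ a + c + b
    regroup = solve-∀
    split : total G + (18 * suc β + 44) + 24 ≡ total G′ + (18 * β + 44) + 2 * (t + 12) + 18
    split = trans (cong (λ w → w + (18 * suc β + 44) + 24) (total-delete conn leaf)) (arrange (total G′) t β)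
      where
      arrange : ∀ w t β → w + 2 * t + (18 * suc β + 44) + 24 ≡ w + (18 * β + 44) + 2 * (t + 12) + 18
      arrange = solve-∀
    d≤α : degree G u ≤ suc β
    d≤α = degree-≤ {G = G} acyclic num u
    t≤K+4d : t + 12 ≤ K + 4 * degree G u
    t≤K+4d = subst (t + 12 ≤_) (regroup (suc n * 8) (4 * degree G u) 16) (leaf-transmission-≤ leaf conn)
    t≤ : t + 12 ≤ K + 4 * suc β
    t≤ = ≤-trans t≤K+4d (+-monoʳ-≤ K (*-monoʳ-≤ 4 d≤α))
    module _ (tight : bound (suc n) (suc β) ≤ total G + (18 * suc β + 44)) where
      t≡ : K + 4 * suc β ≡ t + 12
      t≡ = +-squeeze-scaled 4 ih t≤K+4d d≤α (+-cancelʳ-≤ 18 _ _ (subst₂ _≤_ (grow n β) split (+-monoˡ-≤ 24 tight)))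
      degree≡ : degree G u ≡ suc β
      degree≡ = ≤-antisym d≤α (*-cancelˡ-≤ 4 (+-cancelˡ-≤ K _ _ (≤-trans (≤-reflexive t≡) t≤K+4d)))

  -- For fixed α the bound grows by twice what `leg-transmission` gives at degree α. Slack can come
  -- only from the smaller tree or from a degree of `w` below α, so a tight bound makes `w` the
  -- centre.
  extremal-leg : ∀ {G : Graph (suc n)} {v u w α} → IsTree G → Leaf G v u → v ≢ w → G ⊢ u ~ w →
                 (∀ {x} → G ⊢ u ~ x → x ≡ v ⊎ x ≡ w) → IsStabilityNumber G α →
                 Extremal (delete G v) α → Extremal G α
  extremal-leg {n} {G} {v} {u} {w} {α} (conn , acyclic) leaf v≢w u~w two num (ih , _) =
    +-cancelʳ-≤ 12 _ _ (begin
      total G + (18 * α + 44) + 12                 ≡⟨ split ⟩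
      total G′ + (18 * α + 44) + 2 * (t + 6)       ≤⟨ +-mono-≤ ih (*-monoʳ-≤ 2 t≤) ⟩
      bound n α + 2 * (K + 2 * α)                  ≡⟨ grow n α ⟨
      bound (suc n) α + 12                         ∎) ,
    λ tight diam → w , degree≡ tight , λ x → within diam x
    where
    open ≤-Reasoning
    G′ = delete G v
    t = transmission G v
    K = suc n * 6 + 22
    grow : ∀ n α → 2 * (3 * suc n * suc n + 2 * α * suc n + α * α + 19 * suc n) + 12 ≡
                   2 * (3 * n * n + 2 * α * n + α * α + 19 * n) + 2 * (suc n * 6 + 22 + 2 * α)
    grow = solve-∀
    regroup : ∀ a b c → a + b + c ≡ a + c + b
    regroup = solve-∀
    split : total G + (18 * α + 44) + 12 ≡ total G′ + (18 * α + 44) + 2 * (t + 6)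
    split = trans (cong (λ w → w + (18 * α + 44) + 12) (total-delete conn leaf)) (arrange (total G′) t α)
      where
      arrange : ∀ w t α → w + 2 * t + (18 * α + 44) + 12 ≡ w + (18 * α + 44) + 2 * (t + 6)
      arrange = solve-∀
    d≤α : degree G w ≤ α
    d≤α = degree-≤ {G = G} acyclic num w
    t≤K+2d : t + 6 ≤ K + 2 * degree G w
    t≤K+2d = ≤-reflexive (trans (leg-transmission leaf conn v≢w u~w two) (regroup (suc n * 6) (2 * degree G w) 22))
    t≤ : t + 6 ≤ K + 2 * α
    t≤ = ≤-trans t≤K+2d (+-monoʳ-≤ K (*-monoʳ-≤ 2 d≤α))
    degree≡ : bound (suc n) α ≤ total G + (18 * α + 44) → degree G w ≡ α
    degree≡ tight = ≤-antisym d≤α (*-cancelˡ-≤ 2 (+-cancelˡ-≤ K _ _ (≤-trans (≤-reflexive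
      (+-squeeze-scaled {K = K} 2 ih t≤K+2d d≤α (subst₂ _≤_ (grow n α) split (+-monoˡ-≤ 12 tight)))) t≤K+2d)))
    w~u = ~-sym {G = G} u~w
    u~v = ~-sym {G = G} (leaf .attached)
    -- Unless `x` is `v` or `u`, a shortest walk from `v` begins with `v`, `u`, `w`. Removing these
    -- two edges from a length of at most 4 leaves at most 2.
    within : (∀ x y → dist G x y ≤ 4) → ∀ x → Within G 2 w x
    within diam x with dist G v x | diam v x | dist-walk conn v x | (λ {k} → dist-minimal {G = G} {v} {x} {k})
    ... | zero        | _   | []    | _ = 2 , ≤-refl , w~u ∷ u~v ∷ []
    ... | suc d       | d≤4 | p     | min with leaf-walk leaf p
    ...   | [] = 1 , s≤s z≤n , w~u ∷ []
    ...   | _∷_ {k = k} e q with two e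
    ...     | inj₁ refl = contradiction (min q) (<⇒≱ (m≤n+m _ 1))
    ...     | inj₂ refl = k , ≤-pred (≤-pred d≤4) , q

  extremal : ∀ {n} {G : Graph n} {α} → 2 ≤ n → IsTree G → IsStabilityNumber G α → Extremal G α
  extremal {1} (s≤s ())
  extremal {suc (suc n)} _ = go n
    where
    go : ∀ n {G : Graph (suc (suc n))} {α} → IsTree G → IsStabilityNumber G α → Extremal G α
    go zero    tree num = extremal-edge tree num
    go (suc n) {G} tree num with tree-tip tree
    ... | twin {v} {v′} {u} v≢v′ leaf leaf′ with delete-stability {G = G} num v
    ...   | inj₂ (β , refl , num′) = extremal-near tree leaf num (go n (delete-tree leaf tree) num′)
    -- With twins α must drop: a stable set of size α avoiding `v` would be enlarged by
    -- `twin-enlarge`.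
    ...   | inj₁ ((f , stable , refl) , _) with extend-stable {G = G} v stable
    ...     | g , stable-g , v∉g , size-g with twin-enlarge v≢v′ leaf leaf′ stable-g v∉g
    ...       | h , stable-h , size-h = contradiction (num .proj₂ h stable-h)
                  (<⇒≱ (≤-reflexive (sym (trans size-h (cong suc size-g)))))
    go (suc n) {G} tree num | leg {v} {u} {w} v≢w leaf u~w two with delete-stability {G = G} num v
    ... | inj₂ (β , refl , num′) = extremal-near tree leaf num (go n (delete-tree leaf tree) num′)
    ... | inj₁ num′ = extremal-leg tree leaf v≢w u~w two num (go n (delete-tree leaf tree) num′)

  -- Recognising spurs

  rank : (Fin n → Bool) → Fin n → ℕ
  rank P zero    = 0
  rank P (suc x) = ⟦ P zero ⟧ + rank (P ∘ suc) x

  rank< : ∀ (P : Fin n → Bool) {x} → P x ≡ true → rank P x < size P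
  rank< P {zero}  p rewrite p = s≤s z≤n
  rank< P {suc x} p = +-monoʳ-< ⟦ P zero ⟧ (rank< (P ∘ suc) p)

  rank-injective : ∀ (P : Fin n → Bool) {x y} → P x ≡ true → P y ≡ true → rank P x ≡ rank P y → x ≡ y
  rank-injective P {zero}  {zero}  p q e = refl
  rank-injective P {zero}  {suc y} p q e rewrite p = contradiction e λ ()
  rank-injective P {suc x} {zero}  p q e rewrite q = contradiction e λ ()
  rank-injective P {suc x} {suc y} p q e =
    cong suc (rank-injective (P ∘ suc) p q (+-cancelˡ-≡ ⟦ P zero ⟧ _ _ e))

  -- A member of `P` and its image are erased together; injectivity on `P` keeps the images of the
  -- remaining members in `Q`. The size `k` is carried as the measure of the recursion.
  size-injection : ∀ k {P Q : Fin n → Bool} (g : Fin n → Fin n) → size P ≡ k →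
                   (∀ {x} → P x ≡ true → Q (g x) ≡ true) →
                   (∀ {x y} → P x ≡ true → P y ≡ true → g x ≡ g y → x ≡ y) → size P ≤ size Q
  size-injection zero            g e maps inj = subst (_≤ _) (sym e) z≤n
  size-injection {n} (suc k) {P} {Q} g e maps inj with any? (λ x → P x Bool.≟ true)
  ... | no none = contradiction (trans (sym e) (trans (sum-cong-≗ λ x → cong ⟦_⟧ (¬-not λ p → none (x , p)))
                    (trans (sum-const n 0) (*-zeroʳ n)))) λ ()
  ... | yes (x , px) = subst₂ _≤_ (size-erase P x px) (size-erase Q (g x) (maps px))
      (s≤s (size-injection k g (suc-injective (trans (size-erase P x px) e)) maps′
        λ p q → inj (erase-⊆ {f = P} p) (erase-⊆ {f = P} q)))
    where
    maps′ : ∀ {y} → (P [ x ≔ false ]) y ≡ true → (Q [ g x ≔ false ]) (g y) ≡ true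
    maps′ {y} p = trans (updateAt-minimal (g y) (g x) Q gy≢gx) (maps (erase-⊆ {f = P} p))
      where
      gy≢gx : g y ≢ g x
      gy≢gx q with inj (erase-⊆ {f = P} p) px q
      ... | refl = true≢false p (updateAt-updates x P)

  -- A missed value could be punched out, which would inject m + 1 points into m. Thus a labelling
  -- only has to be injective and in range.
  injective⇒↔ : (f : Fin n → Fin n) → Injective _≡_ _≡_ f → Fin n ↔ Fin n
  injective⇒↔ {n} f inj = mk↔ₛ′ f (proj₁ ∘ surj) (proj₂ ∘ surj) (λ x → inj (proj₂ (surj (f x))))
    where
    missed : ∀ {m} (f : Fin m → Fin m) → Injective _≡_ _≡_ f → ∀ y → (∀ x → y ≢ f x) → ⊥
    missed {suc m} f inj y y≢ = contradiction
      (injective⇒≤ {f = λ x → punchOut (y≢ x)} (inj ∘ punchOut-injective (y≢ _) (y≢ _))) (<⇒≱ ≤-refl)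
    surj : ∀ y → ∃[ x ] f x ≡ y
    surj y with any? (λ x → f x ≟ y)
    ... | yes found = found
    ... | no  none  = ⊥-elim (missed f inj y λ x q → none (x , sym q))

  bool-ext : ∀ {a b} → (a ≡ true → b ≡ true) → (b ≡ true → a ≡ true) → a ≡ b
  bool-ext {true}  {b}     f g = sym (f refl)
  bool-ext {false} {false} f g = refl
  bool-ext {false} {true}  f g = g refl

  -- Adjacency in spurs as a proposition

  SpurEdge : ℕ → ℕ → ℕ → Set
  SpurEdge m i j = (i ≡ 0 × 1 ≤ j × j ≤ m) ⊎ (1 ≤ i × i ≤ m × j ≡ i + m)

  ∨-true : ∀ {a b} → a ∨ b ≡ true → a ≡ true ⊎ b ≡ true
  ∨-true {true}  p = inj₁ refl
  ∨-true {false} p = inj₂ p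

  ∨-introʳ : ∀ a {b} → b ≡ true → a ∨ b ≡ true
  ∨-introʳ true  p = refl
  ∨-introʳ false p = p

  ≤ᵇ-true : ∀ {i j} → (i ≤ᵇ j) ≡ true → i ≤ j
  ≤ᵇ-true {i} {j} p = ≤ᵇ⇒≤ i j (Equivalence.from T-≡ p)

  ≤ᵇ-intro : ∀ {i j} → i ≤ j → (i ≤ᵇ j) ≡ true
  ≤ᵇ-intro p = Equivalence.to T-≡ (≤⇒≤ᵇ p)

  spurEdge⇒ : ∀ {m i j} → spurEdge m i j ≡ true → SpurEdge m i j
  spurEdge⇒ {m} {i} {j} p with ∨-true {(i ≡ᵇ 0) ∧ (1 ≤ᵇ j) ∧ (j ≤ᵇ m)} p
  ... | inj₁ q with ∧-true {i ≡ᵇ 0} q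
  ...   | a , r with ∧-true {1 ≤ᵇ j} r
  ...     | b , d = inj₁ (≡ᵇ-true a , ≤ᵇ-true {1} b , ≤ᵇ-true d)
  spurEdge⇒ {m} {i} {j} p | inj₂ q with ∧-true {1 ≤ᵇ i} q
  ... | a , r with ∧-true {i ≤ᵇ m} r
  ...   | b , d = inj₂ (≤ᵇ-true {1} a , ≤ᵇ-true b , ≡ᵇ-true d)

  spurEdge⇐ : ∀ {m i j} → SpurEdge m i j → spurEdge m i j ≡ true
  spurEdge⇐ {m} {i} {j} (inj₁ (refl , b , d)) = cong (_∨ false) (cong₂ _∧_ (≤ᵇ-intro b) (≤ᵇ-intro d))
  spurEdge⇐ {m} {i} {j} (inj₂ (a , b , refl)) = ∨-introʳ ((i ≡ᵇ 0) ∧ (1 ≤ᵇ j) ∧ (j ≤ᵇ m))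
    (cong₂ _∧_ (≤ᵇ-intro a) (cong₂ _∧_ (≤ᵇ-intro b) (≡ᵇ-diag {i + m} refl)))

  SpurEdge⇒≢ : ∀ {m i j} → SpurEdge m i j → i ≢ j
  SpurEdge⇒≢ (inj₁ (refl , () , _)) refl
  SpurEdge⇒≢ {m} {i} (inj₂ (1≤i , i≤m , eq)) refl = contradiction (≤-trans 1≤i i≤m)
    (<⇒≱ (s≤s (≤-reflexive (+-cancelˡ-≡ i m 0 (trans (sym eq) (sym (+-identityʳ i)))))))

  module _ {m : ℕ} {x y : Fin n} where

    spurAdj⇒ : spurAdj m x y ≡ true → SpurEdge m (toℕ x) (toℕ y) ⊎ SpurEdge m (toℕ y) (toℕ x)
    spurAdj⇒ p with ∧-true {not (toℕ x ≡ᵇ toℕ y)} p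
    ... | _ , q with ∨-true {spurEdge m (toℕ x) (toℕ y)} q
    ...   | inj₁ r = inj₁ (spurEdge⇒ r)
    ...   | inj₂ r = inj₂ (spurEdge⇒ {m} {toℕ y} r)

    spurAdj⇐ : SpurEdge m (toℕ x) (toℕ y) ⊎ SpurEdge m (toℕ y) (toℕ x) → spurAdj m x y ≡ true
    spurAdj⇐ e = cong₂ _∧_ {x = not (toℕ x ≡ᵇ toℕ y)} (cong not (¬-not (distinct e ∘ ≡ᵇ-true))) (either e)
      where
      distinct : SpurEdge m (toℕ x) (toℕ y) ⊎ SpurEdge m (toℕ y) (toℕ x) → toℕ x ≢ toℕ y
      distinct (inj₁ e) = SpurEdge⇒≢ e
      distinct (inj₂ e) = SpurEdge⇒≢ e ∘ sym
      either : SpurEdge m (toℕ x) (toℕ y) ⊎ SpurEdge m (toℕ y) (toℕ x) →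
               spurEdge m (toℕ x) (toℕ y) ∨ spurEdge m (toℕ y) (toℕ x) ≡ true
      either (inj₁ e) = cong (_∨ spurEdge m (toℕ y) (toℕ x)) (spurEdge⇐ {m} {toℕ x} e)
      either (inj₂ e) = ∨-introʳ (spurEdge m (toℕ x) (toℕ y)) (spurEdge⇐ {m} {toℕ y} e)

  module _ {G : Graph n} (acyclic : Acyclic G) where

    -- Two vertices hanging off neighbours of the centre are not adjacent: they would close a cycle
    -- of length five, or a triangle in the degenerate cases `w ≡ w′` and `y ≡ w`.
    no-pentagon : ∀ {c w x y w′} → x ≢ c → y ≢ c → G ⊢ c ~ w → G ⊢ w ~ x → G ⊢ c ~ w′ → G ⊢ w′ ~ y → ¬ G ⊢ x ~ y
    no-pentagon {c} {w} {x} {y} {w′} x≢c y≢c cw wx cw′ w′y xy with w ≟ w′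
    ... | yes refl = no-triangle {G = G} acyclic wx xy w′y
    ... | no w≢w′ with y ≟ w
    ...   | yes refl = no-triangle {G = G} acyclic (~-sym {G = G} cw) cw′ (~-sym {G = G} w′y)
    ...   | no y≢w with neighbour-on-path acyclic path w′y {4} ≤-refl refl
      where
      path : Path G 4 (y ◂ x ◂ w ◂ c ◂ (λ _ → w′))
      path = Path-extend acyclic (Path-extend acyclic (Path-extend acyclic (edge-path acyclic cw′)
               (~-sym {G = G} cw) w≢w′) (~-sym {G = G} wx) x≢c) (~-sym {G = G} xy) y≢w
    ...     | ()

    -- Otherwise replacing w by two of its other neighbours enlarges the independent set N(c).
    only-child : ∀ {c w z₁ z₂} → IsStabilityNumber G (degree G c) → G ⊢ c ~ w →
                 G ⊢ w ~ z₁ → z₁ ≢ c → G ⊢ w ~ z₂ → z₂ ≢ c → z₁ ≡ z₂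
    only-child {c} {w} {z₁} {z₂} (_ , max) cw wz₁ z₁≢c wz₂ z₂≢c with z₁ ≟ z₂
    ... | yes q = q
    ... | no z₁≢z₂ = contradiction (max f₃ (stable-insert {G = G} (stable-insert {G = G} (stable-erase {G = G}
            (neighbours-stable {G = G} acyclic c)) (free wz₁ z₁≢c)) free₂))
            (<⇒≱ (≤-reflexive (sym (trans (size-insert f₂ z₂ z₂∉) (cong suc
              (trans (size-insert f₁ z₁ (outside wz₁ z₁≢c)) (size-erase (adj G c) w cw)))))))
      where
      f₁ = adj G c [ w ≔ false ]
      f₂ = f₁ [ z₁ ≔ true ]
      f₃ = f₂ [ z₂ ≔ true ]
      outside : ∀ {z} → G ⊢ w ~ z → z ≢ c → f₁ z ≡ false
      outside {z} wz z≢c = ¬-not λ p → no-triangle {G = G} acyclic cw wz (erase-⊆ {f = adj G c} p)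
      free : ∀ {z x} → G ⊢ w ~ z → z ≢ c → G ⊢ z ~ x → f₁ x ≡ false
      free {z} {x} wz z≢c zx = ¬-not λ p → true≢false p (trans (cong f₁ (sym
        (no-square {G = G} acyclic (z≢c ∘ sym) cw wz (erase-⊆ {f = adj G c} p) (~-sym {G = G} zx))))
        (updateAt-updates w (adj G c)))
      z₂∉ : f₂ z₂ ≡ false
      z₂∉ = trans (updateAt-minimal z₂ z₁ f₁ (z₁≢z₂ ∘ sym)) (outside wz₂ z₂≢c)
      free₂ : ∀ {x} → G ⊢ z₂ ~ x → f₂ x ≡ false
      free₂ {x} e with x ≟ z₁
      ... | yes refl = contradiction (~-sym {G = G} e) λ e′ → no-triangle {G = G} acyclic wz₁ e′ wz₂
      ... | no x≢z₁  = trans (updateAt-minimal x z₁ f₁ x≢z₁) (free wz₂ z₂≢c e)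

  -- Labelling a centred tree as a spur

  module Labelling {G : Graph n} (acyclic : Acyclic G) {c : Fin n}
                   (num : IsStabilityNumber G (degree G c)) (within : ∀ x → Within G 2 c x) where

    private
      infix 4 _∼_
      _∼_ : Fin n → Fin n → Set
      x ∼ y = G ⊢ x ~ y
      m = degree G c

    child? : ∀ w → Dec (∃[ z ] w ∼ z × z ≢ c)
    child? w = any? (λ z → adj? {G = G} w z ×-dec ¬? (z ≟ c))

    inner outer : Fin n → Bool
    inner w = adj G c w ∧ does (child? w)
    outer w = adj G c w ∧ not (does (child? w))

    a = size inner

    data Role (x : Fin n) : Set where
      centre  : x ≡ c → Role x
      isInner : inner x ≡ true → Role x
      isOuter : outer x ≡ true → Role x
      end     : ∀ {w} → inner w ≡ true → w ∼ x → x ≢ c → Role x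

    inner⇒ : ∀ {w} → inner w ≡ true → c ∼ w
    inner⇒ p = proj₁ (∧-true p)

    outer⇒ : ∀ {w} → outer w ≡ true → c ∼ w
    outer⇒ p = proj₁ (∧-true p)

    inner⇐ : ∀ {w z} → c ∼ w → w ∼ z → z ≢ c → inner w ≡ true
    inner⇐ {w} {z} cw wz z≢c = cong₂ _∧_ cw (dec-true (child? w) (z , wz , z≢c))

    outer-childless : ∀ {w z} → outer w ≡ true → w ∼ z → z ≡ c
    outer-childless {w} {z} p wz with z ≟ c
    ... | yes q = q
    ... | no z≢c = contradiction (cong not (dec-true (child? w) (z , wz , z≢c))) (true≢false (proj₂ (∧-true {adj G c w} p)))

    role : ∀ x → Role x
    role x with within x
    ... | _ , _ , [] = centre refl
    ... | _ , _ , cx ∷ [] with child? x in eq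
    ...   | yes _ = isInner (cong₂ _∧_ cx (cong does eq))
    ...   | no  _ = isOuter (cong₂ _∧_ cx (cong (not ∘ does) eq))
    role x | _ , _ , cw ∷ wx ∷ [] with x ≟ c
    ... | yes q  = centre q
    ... | no x≢c = end (inner⇐ cw wx x≢c) wx x≢c
    role x | _ , s≤s (s≤s ()) , _ ∷ _ ∷ _ ∷ _

    -- Neighbours of the centre with a child take 1, ..., `a` and the others `a + 1`, ..., `m`,
    -- because a spur attaches its outermost vertices to the smallest labels. Labels depend on the
    -- role, so that proofs can match on it.
    label′ : ∀ {x} → Role x → ℕ
    label′     (centre _)        = 0
    label′ {x} (isInner _)       = suc (rank inner x)
    label′ {x} (isOuter _)       = suc (a + rank outer x)
    label′     (end {w} _ _ _)   = suc (rank inner w) + m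

    label : Fin n → ℕ
    label x = label′ (role x)

    inner+outer : a + size outer ≡ m
    inner+outer = trans (sym (∑-distrib-+ (λ x → ⟦ inner x ⟧) (λ x → ⟦ outer x ⟧)))
      (sum-cong-≗ λ x → split (adj G c x) (does (child? x)))
      where
      split : ∀ p q → ⟦ p ∧ q ⟧ + ⟦ p ∧ not q ⟧ ≡ ⟦ p ⟧
      split true  true  = refl
      split true  false = refl
      split false _     = refl

    inner<m : ∀ {x} → inner x ≡ true → suc (rank inner x) ≤ a
    inner<m = rank< inner

    a≤m : a ≤ m
    a≤m = subst (a ≤_) inner+outer (m≤m+n a _)

    outer≤m : ∀ {x} → outer x ≡ true → suc (a + rank outer x) ≤ m
    outer≤m {x} p = begin
      suc (a + rank outer x)  ≡⟨ +-suc a _ ⟨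
      a + suc (rank outer x)  ≤⟨ +-monoʳ-≤ a (rank< outer p) ⟩
      a + size outer          ≡⟨ inner+outer ⟩
      m                       ∎
      where open ≤-Reasoning

    clash : ∀ {i j t} → i ≤ t → t < j → i ≡ j → ⊥
    clash i≤t t<j refl = <⇒≱ t<j i≤t

    label′-injective : ∀ {x y} (r : Role x) (s : Role y) → label′ r ≡ label′ s → x ≡ y
    label′-injective (centre p)  (centre q)  _ = trans p (sym q)
    label′-injective (isInner p) (isInner q) e = rank-injective inner p q (suc-injective e)
    label′-injective (isOuter p) (isOuter q) e =
      rank-injective outer p q (+-cancelˡ-≡ a _ _ (suc-injective e))
    label′-injective (end {w} p wx x≢c) (end {w′} q wy y≢c) e
      with rank-injective inner p q (suc-injective (+-cancelʳ-≡ m _ _ e))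
    ... | refl = only-child {G = G} acyclic num (inner⇒ p) wx x≢c wy y≢c
    label′-injective (isInner p) (isOuter q) e = ⊥-elim (clash (inner<m p) (s≤s (m≤m+n a _)) e)
    label′-injective (isOuter p) (isInner q) e = ⊥-elim (clash (inner<m q) (s≤s (m≤m+n a _)) (sym e))
    label′-injective (isInner p) (end _ _ _) e = ⊥-elim (clash (≤-trans (inner<m p) a≤m) (s≤s (m≤n+m m _)) e)
    label′-injective (end _ _ _) (isInner q) e = ⊥-elim (clash (≤-trans (inner<m q) a≤m) (s≤s (m≤n+m m _)) (sym e))
    label′-injective (isOuter p) (end _ _ _) e = ⊥-elim (clash (outer≤m p) (s≤s (m≤n+m m _)) e)
    label′-injective (end _ _ _) (isOuter q) e = ⊥-elim (clash (outer≤m q) (s≤s (m≤n+m m _)) (sym e))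

    far : Fin n → Bool
    far x = not (does (x ≟ c)) ∧ not (adj G c x)

    order : 1 + m + size far ≡ n
    order = begin
      1 + m + size far                              ≡⟨ cong (_+ size far) (+-comm 1 m) ⟩
      m + 1 + size far                              ≡⟨ cong (_+ size far) (sum-+δ (λ x → ⟦ adj G c x ⟧) 1 c) ⟨
      sum (λ x → ⟦ adj G c x ⟧ + 1 * δ c x) + size far
        ≡⟨ ∑-distrib-+ (λ x → ⟦ adj G c x ⟧ + 1 * δ c x) (λ x → ⟦ far x ⟧) ⟨
      sum (λ x → ⟦ adj G c x ⟧ + 1 * δ c x + ⟦ far x ⟧) ≡⟨ sum-cong-≗ one ⟩
      sum {n} (λ _ → 1)                             ≡⟨ sum-const n 1 ⟩
      n * 1                                         ≡⟨ *-identityʳ n ⟩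
      n                                             ∎
      where
      open ≡-Reasoning
      one : ∀ x → ⟦ adj G c x ⟧ + 1 * δ c x + ⟦ far x ⟧ ≡ 1
      one x with x ≟ c
      ... | yes refl rewrite adj-irrefl G x | δ-diag x = refl
      ... | no x≢c rewrite δ-off (x≢c ∘ sym) with adj G c x
      ...   | true  = refl
      ...   | false = refl

    -- This keeps the labels of the ends below `n`. Children chosen for distinct inner vertices are
    -- distinct because there is no square, and not adjacent to `c` because there is no triangle.
    a≤far : a ≤ size far
    a≤far = size-injection a child refl child-far child-injective
      where
      child : Fin n → Fin n
      child w with child? w
      ... | yes (z , _) = z
      ... | no  _       = w
      child-spec : ∀ {w} → inner w ≡ true → w ∼ child w × child w ≢ c
      child-spec {w} p with child? w | ∧-true {adj G c w} p
      ... | yes (z , found) | _      = found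
      ... | no  _           | _ , ()
      child-far : ∀ {w} → inner w ≡ true → far (child w) ≡ true
      child-far {w} p = cong₂ _∧_ (cong not (dec-false (child w ≟ c) (proj₂ (child-spec p))))
        (cong not (¬-not (no-triangle {G = G} acyclic (inner⇒ p) (proj₁ (child-spec p)))))
      child-injective : ∀ {w w′} → inner w ≡ true → inner w′ ≡ true → child w ≡ child w′ → w ≡ w′
      child-injective {w} {w′} p q e = no-square {G = G} acyclic (proj₂ (child-spec p) ∘ sym) (inner⇒ p) (proj₁ (child-spec p))
        (inner⇒ q) (subst (w′ ∼_) (sym e) (proj₁ (child-spec q)))

    m<n : m < n
    m<n = subst (m <_) order (m≤m+n (suc m) _)

    label′<n : ∀ {x} (r : Role x) → label′ r < n
    label′<n (centre _)      = ≤-<-trans z≤n m<n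
    label′<n (isInner p)     = ≤-<-trans (≤-trans (inner<m p) a≤m) m<n
    label′<n (isOuter p)     = ≤-<-trans (outer≤m p) m<n
    label′<n (end {w} p _ _) = begin-strict
      suc (rank inner w) + m  ≤⟨ +-monoˡ-≤ m (≤-trans (inner<m p) a≤far) ⟩
      size far + m            ≡⟨ +-comm (size far) m ⟩
      m + size far            <⟨ ≤-refl ⟩
      1 + m + size far        ≡⟨ order ⟩
      n                       ∎
      where open ≤-Reasoning

    near-range : ∀ {y} → c ∼ y → (s : Role y) → 1 ≤ label′ s × label′ s ≤ m
    near-range cy (centre refl)     = contradiction cy (~-irrefl {G = G})
    near-range cy (isInner p)       = s≤s z≤n , ≤-trans (inner<m p) a≤m
    near-range cy (isOuter p)       = s≤s z≤n , outer≤m p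
    near-range cy (end p wy _)      = contradiction cy (no-triangle {G = G} acyclic (inner⇒ p) wy)

    near⇐ : ∀ {y} (s : Role y) → 1 ≤ label′ s → label′ s ≤ m → c ∼ y
    near⇐ (isInner p)     _ _  = inner⇒ p
    near⇐ (isOuter p)     _ _  = outer⇒ p
    near⇐ (end _ _ _)     _ le = contradiction le (<⇒≱ (s≤s (m≤n+m m _)))

    Edge : ℕ → ℕ → Set
    Edge i j = SpurEdge m i j ⊎ SpurEdge m j i

    hanging : ∀ {w z} → inner w ≡ true → w ∼ z → (r : Role w) (s : Role z) → z ≢ c → SpurEdge m (label′ r) (label′ s)
    hanging {w} {z} p wz (centre refl) s z≢c = contradiction (inner⇒ p) (~-irrefl {G = G})
    hanging {w} {z} p wz (isOuter q)   s z≢c = contradiction (outer-childless q wz) z≢c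
    hanging {w} {z} p wz (end q w′w _) s z≢c = contradiction (inner⇒ p) (no-triangle {G = G} acyclic (inner⇒ q) w′w)
    hanging {w} {z} p wz (isInner _) (centre q)  z≢c = contradiction q z≢c
    hanging {w} {z} p wz (isInner _) (isInner q) z≢c = contradiction (inner⇒ q) (no-triangle {G = G} acyclic (inner⇒ p) wz)
    hanging {w} {z} p wz (isInner _) (isOuter q) z≢c = contradiction (outer⇒ q) (no-triangle {G = G} acyclic (inner⇒ p) wz)
    -- The role of `z` may record its own parent `w′`; the absence of squares identifies it with
    -- `w`.
    hanging {w} {z} p wz (isInner _) (end q w′z _) z≢c
      with no-square {G = G} acyclic (z≢c ∘ sym) (inner⇒ p) wz (inner⇒ q) w′z
    ... | refl = inj₂ (s≤s z≤n , ≤-trans (inner<m p) a≤m , refl)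

    edge⇒ : ∀ {x y} → x ∼ y → (r : Role x) (s : Role y) → Edge (label′ r) (label′ s)
    edge⇒ xy (centre refl) s = inj₁ (inj₁ (refl , near-range xy s))
    edge⇒ xy r (centre refl) = inj₂ (inj₁ (refl , near-range (~-sym {G = G} xy) r))
    edge⇒ xy (isInner p) (isInner q) = contradiction (inner⇒ q) (no-triangle {G = G} acyclic (inner⇒ p) xy)
    edge⇒ xy (isInner p) (isOuter q) = contradiction (outer⇒ q) (no-triangle {G = G} acyclic (inner⇒ p) xy)
    edge⇒ xy (isOuter p) (isInner q) = contradiction (inner⇒ q) (no-triangle {G = G} acyclic (outer⇒ p) xy)
    edge⇒ xy (isOuter p) (isOuter q) = contradiction (outer⇒ q) (no-triangle {G = G} acyclic (outer⇒ p) xy)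
    edge⇒ xy (isInner p) s@(end _ _ y≢c) = inj₁ (hanging p xy (isInner p) s y≢c)
    edge⇒ xy r@(end _ _ x≢c) (isInner q) = inj₂ (hanging q (~-sym {G = G} xy) (isInner q) r x≢c)
    edge⇒ xy (isOuter p) (end _ _ y≢c) = contradiction (outer-childless p xy) y≢c
    edge⇒ xy (end _ _ x≢c) (isOuter q) = contradiction (outer-childless q (~-sym {G = G} xy)) x≢c
    edge⇒ xy (end p wx x≢c) (end q w′y y≢c) =
      contradiction xy (no-pentagon {G = G} acyclic x≢c y≢c (inner⇒ p) wx (inner⇒ q) w′y)

    edge⇐ : ∀ {x y} (r : Role x) (s : Role y) → SpurEdge m (label′ r) (label′ s) → x ∼ y
    edge⇐ (centre refl) s (inj₁ (_ , 1≤j , j≤m))  = near⇐ s 1≤j j≤m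
    edge⇐ (isInner p) (end {w} q wy _) (inj₂ (_ , _ , e)) =
      subst (_∼ _) (rank-injective inner q p (suc-injective (+-cancelʳ-≡ m _ _ e))) wy
    -- Ends hang only at labels up to `a`, whereas outer labels exceed `a`.
    edge⇐ {x} (isOuter p) (end {w} q wy _) (inj₂ (_ , _ , e)) =
      ⊥-elim (clash (inner<m q) (s≤s (m≤m+n a (rank outer x))) (+-cancelʳ-≡ m _ _ e))
    edge⇐ (isInner p) (isInner q) (inj₂ (_ , _ , e)) = ⊥-elim (clash (≤-trans (inner<m q) a≤m) (s≤s (m≤n+m m _)) e)
    edge⇐ (isInner p) (isOuter q) (inj₂ (_ , _ , e)) = ⊥-elim (clash (outer≤m q) (s≤s (m≤n+m m _)) e)
    edge⇐ (isOuter p) (isInner q) (inj₂ (_ , _ , e)) = ⊥-elim (clash (≤-trans (inner<m q) a≤m) (s≤s (m≤n+m m _)) e)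
    edge⇐ (isOuter p) (isOuter q) (inj₂ (_ , _ , e)) = ⊥-elim (clash (outer≤m q) (s≤s (m≤n+m m _)) e)
    edge⇐ (end _ _ _) s (inj₂ (_ , le , _)) = contradiction le (<⇒≱ (s≤s (m≤n+m m _)))

    position : Fin n → Fin n
    position x = fromℕ< (label′<n (role x))

    toℕ-position : ∀ x → toℕ (position x) ≡ label x
    toℕ-position x = toℕ-fromℕ< (label′<n (role x))

    position-injective : Injective _≡_ _≡_ position
    position-injective {x} {y} e = label′-injective (role x) (role y)
      (trans (sym (toℕ-position x)) (trans (cong toℕ e) (toℕ-position y)))

    spur-isomorphism : G ≅ spur n m
    spur-isomorphism = injective⇒↔ position position-injective , λ x y → bool-ext (to x y) (from x y)
      where
      to : ∀ x y → x ∼ y → spurAdj m (position x) (position y) ≡ true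
      to x y e = spurAdj⇐ {m = m} {position x} {position y}
        (subst₂ Edge (sym (toℕ-position x)) (sym (toℕ-position y)) (edge⇒ e (role x) (role y)))
      from : ∀ x y → spurAdj m (position x) (position y) ≡ true → x ∼ y
      from x y p with subst₂ Edge (toℕ-position x) (toℕ-position y) (spurAdj⇒ {m = m} {position x} {position y} p)
      ... | inj₁ e = edge⇐ (role x) (role y) e
      ... | inj₂ e = ~-sym {G = G} (edge⇐ (role y) (role x) e)

  -- The value attained by spurs

  module _ {G H : Graph n} (iso : G ≅ H) where

    open Inverse (proj₁ iso) using (to; from; strictlyInverseˡ; strictlyInverseʳ)

    iso-walk : ∀ {k x y} → Walk G k x y → Walk H k (to x) (to y)
    iso-walk []                  = []
    iso-walk (_∷_ {x = x} {z} e w) = trans (sym (proj₂ iso x z)) e ∷ iso-walk w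

    iso-walk⁻ : ∀ {k x y} → Walk H k x y → Walk G k (from x) (from y)
    iso-walk⁻ []      = []
    iso-walk⁻ (_∷_ {x = x} {z} e w) = trans (proj₂ iso (from x) (from z))
      (subst₂ (H ⊢_~_) (sym (strictlyInverseˡ x)) (sym (strictlyInverseˡ z)) e) ∷ iso-walk⁻ w

    iso-connected : Connected G → Connected H
    iso-connected conn = connected-from-walks walk
      where
      walk : ∀ x y → ∃[ k ] Walk H k x y
      walk x y with connected-walk conn (from x) (from y)
      ... | k , w = k , subst₂ (Walk H k) (strictlyInverseˡ x) (strictlyInverseˡ y) (iso-walk w)

    iso-dist : Connected G → ∀ x y → dist G x y ≡ dist H (to x) (to y)
    iso-dist conn x y = ≤-antisym
      (dist-≤-of-walks (iso-connected conn) λ {k} w → k , ≤-refl ,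
        subst₂ (Walk G k) (strictlyInverseʳ x) (strictlyInverseʳ y) (iso-walk⁻ w))
      (dist-≤-of-walks conn λ {k} w → k , ≤-refl , iso-walk w)

    iso-total : Connected G → total G ≡ total H
    iso-total conn = begin
      sum (λ x → sum (λ y → γ (dist G x y)))            ≡⟨ sum-cong-≗ (λ x → sum-cong-≗ λ y → cong γ (iso-dist conn x y)) ⟩
      sum (λ x → sum (λ y → γ (dist H (to x) (to y))))  ≡⟨ sum-cong-≗ (λ x → sum-permute (λ y → γ (dist H (to x) y)) (proj₁ iso)) ⟨
      sum (λ x → transmission H (to x))                 ≡⟨ sum-permute (transmission H) (proj₁ iso) ⟨
      total H                                           ∎
      where open ≡-Reasoning

  within⇒connected : {G : Graph n} {c : Fin n} → (∀ x → Within G 2 c x) → Connected G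
  within⇒connected h = connected-from-walks λ x y →
    _ , reverse (proj₂ (proj₂ (h x))) ++ʷ proj₂ (proj₂ (h y))

  within⇒dist≤4 : {G : Graph n} {c : Fin n} → (∀ x → Within G 2 c x) → ∀ x y → dist G x y ≤ 4
  within⇒dist≤4 h x y = ≤-trans
    (dist-minimal (reverse (proj₂ (proj₂ (h x))) ++ʷ proj₂ (proj₂ (h y))))
    (+-mono-≤ (proj₁ (proj₂ (h x))) (proj₁ (proj₂ (h y))))

  count-below : ∀ n m → sum {n} (λ j → ⟦ toℕ j <ᵇ m ⟧) ≡ n ⊓ m
  count-below zero    m       = refl
  count-below (suc n) zero    = trans (sum-const n 0) (*-zeroʳ n)
  count-below (suc n) (suc m) = cong suc (count-below n m)

  module _ {N m : ℕ} where

    private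
      S = spur (suc N) m

    spur-~ : ∀ {x y : Fin (suc N)} → SpurEdge m (toℕ x) (toℕ y) → S ⊢ x ~ y
    spur-~ {x} {y} e = spurAdj⇐ {m = m} {x} {y} (inj₁ e)

    -- The minimum covers `m` exceeding `N`, which occurs while a star is dismantled with `m` fixed.
    spur-degree : degree S zero ≡ N ⊓ m
    spur-degree = trans (sum-cong-≗ λ j → cong ⟦_⟧ (bool-ext (to j) (from j))) (count-below N m)
      where
      to : ∀ j → spurAdj m (zero {n = N}) (suc j) ≡ true → (toℕ j <ᵇ m) ≡ true
      to j p with spurAdj⇒ {m = m} {zero} {suc j} p
      ... | inj₁ (inj₁ (_ , _ , j<m))       = ≤ᵇ-intro j<m
      ... | inj₁ (inj₂ (() , _))
      ... | inj₂ (inj₁ (() , _))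
      ... | inj₂ (inj₂ (_ , _ , ()))
      from : ∀ j → (toℕ j <ᵇ m) ≡ true → spurAdj m (zero {n = N}) (suc j) ≡ true
      from j p = spur-~ {zero} {suc j} (inj₁ (refl , s≤s z≤n , ≤ᵇ-true p))

    spur-within : N ≤ m + m → ∀ x → Within S 2 zero x
    spur-within N≤ zero    = 0 , z≤n , []
    spur-within N≤ (suc x) with suc (toℕ x) ≤? m
    ... | yes x≤m = 1 , s≤s z≤n , spur-~ {zero} {suc x} (inj₁ (refl , s≤s z≤n , x≤m)) ∷ []
    ... | no  x≰m = 2 , ≤-refl , _∷_ {z = u} 0~u (u~x ∷ [])
      where
      -- A label above `m` hangs at the label smaller by `m`, which `N ≤ m + m` keeps at most `m`.
      i = suc (toℕ x) ∸ m
      i<N : i < suc N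
      i<N = ≤-<-trans (m∸n≤m (suc (toℕ x)) m) (toℕ<n (suc x))
      u = fromℕ< i<N
      u≡ : toℕ u ≡ i
      u≡ = toℕ-fromℕ< i<N
      1≤i : 1 ≤ i
      1≤i = m<n⇒0<n∸m (≰⇒> x≰m)
      i≤m : i ≤ m
      i≤m = subst (i ≤_) (m+n∸n≡m m m) (∸-monoˡ-≤ m (≤-trans (≤-pred (toℕ<n (suc x))) N≤))
      0~u : S ⊢ zero ~ u
      0~u = spur-~ {zero} {u} (inj₁ (refl , subst (λ i → 1 ≤ i × i ≤ m) (sym u≡) (1≤i , i≤m)))
      u~x : S ⊢ u ~ (suc x)
      u~x = spur-~ {u} {suc x} (inj₂ (subst (λ i → 1 ≤ i × i ≤ m × suc (toℕ x) ≡ i + m) (sym u≡)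
              (1≤i , i≤m , sym (m∸n+n≡m (<⇒≤ (≰⇒> x≰m))))))

    last : Fin (suc N)
    last = fromℕ N

    toℕ-last : toℕ last ≡ N
    toℕ-last = toℕ-fromℕ N

    star-leaf : 1 ≤ N → N ≤ m → Leaf S last zero
    star-leaf 1≤N N≤m .attached = spurAdj⇐ {m = m} {last} {zero}
      (inj₂ (inj₁ (refl , subst (λ i → 1 ≤ i × i ≤ m) (sym toℕ-last) (1≤N , N≤m))))
    star-leaf 1≤N N≤m .only {x} p with spurAdj⇒ {m = m} {last} {x} p
    ... | inj₁ (inj₁ (l≡0 , _)) = contradiction (subst (1 ≤_) (trans (sym toℕ-last) l≡0) 1≤N) λ ()
    ... | inj₁ (inj₂ (_ , _ , e)) = contradiction (≤-pred (toℕ<n x)) (<⇒≱ (begin-strict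
            N          <⟨ m<m+n N (≤-trans 1≤N N≤m) ⟩
            N + m      ≡⟨ cong (_+ m) toℕ-last ⟨
            toℕ last + m ≡⟨ e ⟨
            toℕ x      ∎))
      where open ≤-Reasoning
    ... | inj₂ (inj₁ (x≡0 , _)) = toℕ-injective x≡0
    ... | inj₂ (inj₂ (1≤x , _ , e)) = contradiction N≤m (<⇒≱ (begin-strict
            m          <⟨ m<n+m m 1≤x ⟩
            toℕ x + m  ≡⟨ e ⟨
            toℕ last   ≡⟨ toℕ-last ⟩
            N          ∎))
      where open ≤-Reasoning

    module _ {k : ℕ} (1≤k : 1 ≤ k) (k≤m : k ≤ m) (N≡ : N ≡ k + m) where

      private
        k<N : k < suc N
        k<N = s≤s (subst (k ≤_) (sym N≡) (m≤m+n k m))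

      foot : Fin (suc N)
      foot = fromℕ< k<N

      toℕ-foot : toℕ foot ≡ k
      toℕ-foot = toℕ-fromℕ< k<N

      private
        last≡ : toℕ last ≡ k + m
        last≡ = trans toℕ-last N≡

      leg-leaf : Leaf S last foot
      leg-leaf .attached = spurAdj⇐ {m = m} {last} {foot} (inj₂ (inj₂
        (subst (λ i → 1 ≤ i × i ≤ m × toℕ last ≡ i + m) (sym toℕ-foot) (1≤k , k≤m , last≡))))
      leg-leaf .only {x} p with spurAdj⇒ {m = m} {last} {x} p
      ... | inj₁ (inj₁ (l≡0 , _)) = contradiction (≤-trans 1≤k (m≤m+n k m)) (<⇒≱ (s≤s (≤-reflexive (trans (sym last≡) l≡0))))
      ... | inj₁ (inj₂ (_ , l≤m , _)) = contradiction (subst (_≤ m) last≡ l≤m) (<⇒≱ (m<n+m m 1≤k))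
      ... | inj₂ (inj₁ (_ , _ , l≤m)) = contradiction (subst (_≤ m) last≡ l≤m) (<⇒≱ (m<n+m m 1≤k))
      ... | inj₂ (inj₂ (_ , _ , e)) = toℕ-injective (trans (+-cancelʳ-≡ m _ _ (trans (sym e) last≡)) (sym toℕ-foot))

      last≢0 : last ≢ zero
      last≢0 q = contradiction (≤-trans 1≤k (m≤m+n k m)) (<⇒≱ (s≤s (≤-reflexive (trans (sym last≡) (cong toℕ q)))))

      foot~0 : S ⊢ foot ~ zero
      foot~0 = spurAdj⇐ {m = m} {foot} {zero} (inj₂ (inj₁ (refl , subst (λ i → 1 ≤ i × i ≤ m) (sym toℕ-foot) (1≤k , k≤m))))

      foot-two : ∀ {x} → S ⊢ foot ~ x → x ≡ last ⊎ x ≡ zero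
      foot-two {x} p with spurAdj⇒ {m = m} {foot} {x} p
      ... | inj₁ (inj₁ (f≡0 , _)) = contradiction 1≤k (<⇒≱ (s≤s (≤-reflexive (trans (sym toℕ-foot) f≡0))))
      ... | inj₁ (inj₂ (_ , _ , e)) = inj₁ (toℕ-injective (trans e (trans (cong (_+ m) toℕ-foot) (sym last≡))))
      ... | inj₂ (inj₁ (x≡0 , _)) = inj₂ (toℕ-injective x≡0)
      ... | inj₂ (inj₂ (1≤x , _ , e)) = contradiction k≤m (<⇒≱ (subst (m <_) (trans (sym e) toℕ-foot) (m<n+m m 1≤x)))

  toℕ-punchIn-fromℕ : ∀ n (x : Fin n) → toℕ (punchIn (fromℕ n) x) ≡ toℕ x
  toℕ-punchIn-fromℕ (suc n) zero    = refl
  toℕ-punchIn-fromℕ (suc n) (suc x) = cong suc (toℕ-punchIn-fromℕ n x)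

  -- Adjacency depends only on the labels, and removing the largest one leaves the others unchanged.
  spur-delete : ∀ N m → delete (spur (suc N) m) (fromℕ N) ≅ spur N m
  spur-delete N m = ↔-id _ , λ x y → cong₂ (λ i j → not (i ≡ᵇ j) ∧ (spurEdge m i j ∨ spurEdge m j i))
    (toℕ-punchIn-fromℕ N x) (toℕ-punchIn-fromℕ N y)

  spur-total-step : ∀ N m {u} → Connected (spur (suc N) m) → Leaf (spur (suc N) m) (fromℕ N) u →
    total (spur (suc N) m) ≡ total (spur N m) + 2 * transmission (spur (suc N) m) (fromℕ N)
  spur-total-step N m conn leaf = trans (total-delete conn leaf)
    (cong (_+ 2 * transmission (spur (suc N) m) (fromℕ N)) (iso-total (spur-delete N m) (delete-connected leaf conn)))

  -- For `N ≤ m` the spur is a star with `N` leaves whatever `m` is, so `m` stays fixed as leaves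
  -- are removed. The recursion ends at a single vertex with the formal parameter 0, where both
  -- sides are 44.
  star-total : ∀ N m → N ≤ m → total (spur (suc N) m) + (18 * N + 44) ≡ bound (suc N) N
  star-total zero    m _   = cong (λ d → γ d + 0 + 0 + 44) (dist-self {G = spur 1 m} zero)
  star-total (suc N) m N<m = +-cancelʳ-≡ 24 _ _ (begin
    total S + (18 * suc N + 44) + 24                             ≡⟨ cong (λ w → w + (18 * suc N + 44) + 24) (spur-total-step (suc N) m conn leaf) ⟩
    total (spur (suc N) m) + 2 * t + (18 * suc N + 44) + 24      ≡⟨ arrange (total (spur (suc N) m)) t N ⟩
    total (spur (suc N) m) + (18 * N + 44) + 2 * (t + 12) + 18   ≡⟨ cong₂ (λ a b → a + 2 * b + 18) (star-total N m (<⇒≤ N<m)) t≡ ⟩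
    bound (suc N) N + 2 * (suc (suc N) * 8 + 4 * suc N + 16) + 18 ≡⟨ grow N ⟨
    bound (suc (suc N)) (suc N) + 24                             ∎)
    where
    open ≡-Reasoning
    S = spur (suc (suc N)) m
    leaf = star-leaf {suc N} {m} (s≤s z≤n) N<m
    within = spur-within {suc N} {m} (≤-trans N<m (m≤m+n m m))
    conn = within⇒connected {G = S} within
    t = transmission S (fromℕ (suc N))
    t≡ : t + 12 ≡ suc (suc N) * 8 + 4 * suc N + 16
    t≡ = trans (leaf-transmission-exact leaf conn within) (cong (λ d → suc (suc N) * 8 + 4 * d + 16)
           (trans (spur-degree {suc N} {m}) (m≤n⇒m⊓n≡m N<m)))
    arrange : ∀ w t N → w + 2 * t + (18 * suc N + 44) + 24 ≡ w + (18 * N + 44) + 2 * (t + 12) + 18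
    arrange = solve-∀
    grow : ∀ N → 2 * (3 * suc (suc N) * suc (suc N) + 2 * suc N * suc (suc N) + suc N * suc N + 19 * suc (suc N)) + 24 ≡
      2 * (3 * suc N * suc N + 2 * N * suc N + N * N + 19 * suc N) + 2 * (suc (suc N) * 8 + 4 * suc N + 16) + 18
    grow = solve-∀

  -- `k` counts the neighbours of the centre that carry a further vertex. The largest label is
  -- always the end of such a leg, and its contribution is exact with the centre of degree `m` as
  -- `w`.
  spur-total : ∀ k m → k ≤ m → total (spur (suc (k + m)) m) + (18 * m + 44) ≡ bound (suc (k + m)) m
  spur-total zero    m _   = star-total m m ≤-refl
  spur-total (suc k) m k<m = +-cancelʳ-≡ 12 _ _ (begin
    total S + (18 * m + 44) + 12                          ≡⟨ cong (λ w → w + (18 * m + 44) + 12) (spur-total-step N m conn leaf) ⟩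
    total (spur N m) + 2 * t + (18 * m + 44) + 12         ≡⟨ arrange (total (spur N m)) t m ⟩
    total (spur N m) + (18 * m + 44) + 2 * (t + 6)        ≡⟨ cong₂ (λ a b → a + 2 * b) (spur-total k m (<⇒≤ k<m)) t≡ ⟩
    bound N m + 2 * (suc N * 6 + 2 * m + 22)              ≡⟨ grow N m ⟨
    bound (suc N) m + 12                                  ∎)
    where
    open ≡-Reasoning
    N = suc (k + m)
    S = spur (suc N) m
    leaf = leg-leaf {N} {m} (s≤s z≤n) k<m refl
    conn = within⇒connected {G = S} (spur-within {N} {m} (+-monoˡ-≤ m k<m))
    t = transmission S (fromℕ N)
    t≡ : t + 6 ≡ suc N * 6 + 2 * m + 22
    t≡ = trans (leg-transmission leaf conn (last≢0 {N} {m} (s≤s z≤n) k<m refl) (foot~0 {N} {m} (s≤s z≤n) k<m refl)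
                 (foot-two {N} {m} (s≤s z≤n) k<m refl))
           (cong (λ d → suc N * 6 + 2 * d + 22) (trans (spur-degree {N} {m}) (m≥n⇒m⊓n≡n (m≤n+m m (suc k)))))
    arrange : ∀ w t m → w + 2 * t + (18 * m + 44) + 12 ≡ w + (18 * m + 44) + 2 * (t + 6)
    arrange = solve-∀
    grow : ∀ N m → 2 * (3 * suc N * suc N + 2 * m * suc N + m * m + 19 * suc N) + 12 ≡
                   2 * (3 * N * N + 2 * m * N + m * m + 19 * N) + 2 * (suc N * 6 + 2 * m + 22)
    grow = solve-∀

  -- In a spur with n > 2m + 1 the vertex numbered 2m + 1 would be isolated.
  connected-spur-order : ∀ {N m} → Connected (spur (suc N) m) → N ≤ m + m
  connected-spur-order {N} {m} conn = ≮⇒≥ λ m+m<N → isolated m+m<N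
    where
    isolated : ¬ m + m < N
    isolated lt with first-step (proj₂ (connected-walk conn z zero)) z≢0
      where
      z = fromℕ< (s≤s lt)
      z≢0 : z ≢ zero
      z≢0 ()
    ... | x , p with spurAdj⇒ {m = m} {fromℕ< (s≤s lt)} {x} p
    ...   | inj₁ (inj₁ (() , _))
    ...   | inj₁ (inj₂ (_ , z≤m , _)) = contradiction (≤-trans (≤-reflexive (sym (toℕ-fromℕ< (s≤s lt)))) z≤m) (<⇒≱ (s≤s (m≤m+n m m)))
    ...   | inj₂ (inj₁ (_ , _ , z≤m)) = contradiction (≤-trans (≤-reflexive (sym (toℕ-fromℕ< (s≤s lt)))) z≤m) (<⇒≱ (s≤s (m≤m+n m m)))
    ...   | inj₂ (inj₂ (_ , x≤m , e)) = contradiction (+-monoˡ-≤ m x≤m) (<⇒≱ (≤-reflexive (trans (sym (toℕ-fromℕ< (s≤s lt))) e)))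

  -- A stable set of full size would contain both ends of an edge. The inequality ensures that the
  -- spur really has `m` neighbours at its centre, as `spur-total` requires.
  stability<order : ∀ {G : Graph (suc (suc n))} {α} → Connected G → IsStabilityNumber G α → α ≤ suc n
  stability<order {n} {G} conn ((f , stable , refl) , _) with size f ≤? suc n
  ... | yes le = le
  ... | no  gt with first-step (proj₂ (connected-walk conn zero (suc zero))) (λ ())
  ...   | y , 0~y = contradiction (stable zero y (full zero) (full y)) (true≢false 0~y)
    where
    ⟦⟧≤1 : ∀ b → ⟦ b ⟧ ≤ 1
    ⟦⟧≤1 true  = ≤-refl
    ⟦⟧≤1 false = z≤n
    full : ∀ x → f x ≡ true
    full x with f x | sum-squeeze (λ x → ⟦⟧≤1 (f x)) (subst (_≤ size f) (sym (trans (sum-const (suc (suc n)) 1) (*-identityʳ _))) (≰⇒> gt)) x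
    ... | true | _ = refl

  spur-total-of-connected : ∀ {n m} → Connected (spur (suc n) m) → m ≤ n →
                            total (spur (suc n) m) + (18 * m + 44) ≡ bound (suc n) m
  spur-total-of-connected {n} {m} conn m≤n = subst (λ n → total (spur (suc n) m) + (18 * m + 44) ≡ bound (suc n) m)
    (m∸n+n≡m m≤n) (spur-total (n ∸ m) m (subst (n ∸ m ≤_) (m+n∸n≡m m m) (∸-monoˡ-≤ m (connected-spur-order conn))))

  -- Connectivity, carried over by the isomorphism, bounds the order of the spur; this yields its
  -- value and the diameter bound that makes the weights exact.
  extremal-spur : ∀ {G : Graph n} {α} → 2 ≤ n → Connected G → IsStabilityNumber G α → G ≅ spur n α →
                  total G + (18 * α + 44) ≡ bound n α × (∀ x y → dist G x y ≤ 4)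
  extremal-spur {1} (s≤s ())
  extremal-spur {suc (suc n)} {G} {α} _ conn num iso =
    trans (cong (_+ (18 * α + 44)) (iso-total {H = S} iso conn))
          (spur-total-of-connected conn′ (stability<order {G = G} conn num)) ,
    λ x y → subst (_≤ 4) (sym (iso-dist {H = S} iso conn x y))
              (within⇒dist≤4 {G = S} (spur-within {suc n} {α} (connected-spur-order conn′)) (to x) (to y))
    where
    open Inverse (proj₁ iso) using (to)
    S = spur (suc (suc n)) α
    conn′ : Connected S
    conn′ = iso-connected iso conn

  extremal-isomorphic : ∀ {G : Graph n} {α} → Acyclic G → IsStabilityNumber G α → Centred G α → G ≅ spur n α
  extremal-isomorphic acyclic num (c , refl , within) = Labelling.spur-isomorphism acyclic num within

open Combinatorics
open import Data.Integer using (ℤ; +_; _+_; _-_; _*_)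
import Data.Integer as ℤ
import Data.Integer.Properties as ℤ
open import Data.Integer.Tactic.RingSolver using () renaming (solve-∀ to solveℤ)
open import Data.Rational using (ℚ; 0ℚ; _/_; toℚᵘ)
open import Data.Rational using () renaming (_≤_ to _≤ℚ_)
import Data.Rational as ℚ
import Data.Rational.Properties as ℚ
open import Data.Rational.Unnormalised using (mkℚᵘ; *≡*; *≤*; *<*)
import Data.Rational.Unnormalised as ℚᵘ
import Data.Rational.Unnormalised.Properties as ℚᵘ
open import Function.Bundles using (_⇔_; mk⇔)
open import Relation.Binary.Definitions using (tri<; tri≈; tri>)

private variable
  n : ℕ

-- From weights to the Harary index

-- `_/_` reduces to lowest terms, so arithmetic over the common denominator passes through
-- unnormalised fractions, which store 24 as its predecessor 23.
toℚᵘ-/24 : ∀ i → toℚᵘ (i / 24) ℚᵘ.≃ mkℚᵘ i 23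
toℚᵘ-/24 i = ℚ.toℚᵘ-fromℚᵘ (mkℚᵘ i 23)

/24-+ : ∀ i j → i / 24 ℚ.+ j / 24 ≡ (i + j) / 24
/24-+ i j = ℚ.toℚᵘ-injective (begin
  toℚᵘ (i / 24 ℚ.+ j / 24)          ≈⟨ ℚ.toℚᵘ-homo-+ (i / 24) (j / 24) ⟩
  toℚᵘ (i / 24) ℚᵘ.+ toℚᵘ (j / 24)  ≈⟨ ℚᵘ.+-cong (toℚᵘ-/24 i) (toℚᵘ-/24 j) ⟩
  mkℚᵘ i 23 ℚᵘ.+ mkℚᵘ j 23          ≈⟨ *≡* (cross i j) ⟩
  mkℚᵘ (i + j) 23                   ≈⟨ toℚᵘ-/24 (i + j) ⟨
  toℚᵘ ((i + j) / 24)               ∎)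
  where
  open ℚᵘ.≃-Reasoning
  cross : ∀ i j → (i * + 24 + j * + 24) * + 24 ≡ (i + j) * + 576
  cross = solveℤ

/24-mono : ∀ {i j} → i ℤ.≤ j → i / 24 ≤ℚ j / 24
/24-mono {i} {j} i≤j = ℚ.toℚᵘ-cancel-≤ (ℚᵘ.≤-respˡ-≃ (ℚᵘ.≃-sym (toℚᵘ-/24 i)) (ℚᵘ.≤-respʳ-≃ (ℚᵘ.≃-sym (toℚᵘ-/24 j))
  (*≤* (ℤ.*-monoʳ-≤-nonNeg (+ 24) i≤j))))

/24-injective : ∀ {i j} → i / 24 ≡ j / 24 → i ≡ j
/24-injective {i} {j} e with ℚᵘ.≃-trans (ℚᵘ.≃-sym (toℚᵘ-/24 i)) (ℚᵘ.≃-trans (ℚ.toℚᵘ-cong e) (toℚᵘ-/24 j))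
... | *≡* eq = ℤ.*-cancelʳ-≡ i j (+ 24) eq

sumFin-cong : {f g : Fin n → ℚ} → (∀ x → f x ≡ g x) → sumFin f ≡ sumFin g
sumFin-cong {zero}  h = refl
sumFin-cong {suc n} h = cong₂ ℚ._+_ (h zero) (sumFin-cong (h ∘ suc))

sumFin-mono : {f g : Fin n → ℚ} → (∀ x → f x ≤ℚ g x) → sumFin f ≤ℚ sumFin g
sumFin-mono {zero}  h = ℚ.≤-refl
sumFin-mono {suc n} h = ℚ.+-mono-≤ (h zero) (sumFin-mono (h ∘ suc))

sumFin-mono-< : {f g : Fin n → ℚ} → (∀ x → f x ≤ℚ g x) → ∀ x → f x ℚ.< g x → sumFin f ℚ.< sumFin g
sumFin-mono-< h zero    lt = ℚ.+-mono-<-≤ lt (sumFin-mono (h ∘ suc))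
sumFin-mono-< h (suc x) lt = ℚ.+-mono-≤-< (h zero) (sumFin-mono-< (h ∘ suc) x lt)

sumFin-/24 : (f : Fin n → ℕ) → sumFin (λ x → + f x / 24) ≡ + sum f / 24
sumFin-/24 {zero}  f = refl
sumFin-/24 {suc n} f = trans (cong (+ f zero / 24 ℚ.+_) (sumFin-/24 (f ∘ suc)))
  (/24-+ (+ f zero) (+ sum (f ∘ suc)))

inv-exact : ∀ {d} → d ≤ 4 → inv d ≡ + γ d / 24
inv-exact {0} _ = refl
inv-exact {1} _ = refl
inv-exact {2} _ = refl
inv-exact {3} _ = refl
inv-exact {4} _ = refl
inv-exact {suc (suc (suc (suc (suc _))))} (s≤s (s≤s (s≤s (s≤s ()))))

-- With the distance written as 5 + d, cross-multiplication leaves 24 < 6 (5 + d).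
inv-strict : ∀ {d} → 4 < d → inv d ℚ.< + γ d / 24
inv-strict {suc (suc (suc (suc (suc d))))} _ = ℚ.toℚᵘ-cancel-<
  (ℚᵘ.<-respˡ-≃ (ℚᵘ.≃-sym (ℚ.toℚᵘ-fromℚᵘ (mkℚᵘ (+ 1) (4 ℕ.+ d)))) (ℚᵘ.<-respʳ-≃ (ℚᵘ.≃-sym (toℚᵘ-/24 (+ 6)))
  (*<* (ℤ.+<+ (ℕ.≤-trans (s≤s (ℕ.m≤m+n 24 _)) (ℕ.≤-reflexive (expand d)))))))
  where
  expand : ∀ d → 25 ℕ.+ (5 ℕ.+ 6 ℕ.* d) ≡ 6 ℕ.* (5 ℕ.+ d)
  expand = solve-∀
inv-strict {1} (s≤s ())
inv-strict {2} (s≤s (s≤s ()))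
inv-strict {3} (s≤s (s≤s (s≤s ())))
inv-strict {4} (s≤s (s≤s (s≤s (s≤s ()))))

inv-≤ : ∀ d → inv d ≤ℚ + γ d / 24
inv-≤ d with d ℕ.≤? 4
... | yes d≤4 = ℚ.≤-reflexive (inv-exact d≤4)
... | no  d≰4 = ℚ.<⇒≤ (inv-strict (ℕ.≰⇒> d≰4))

module _ (G : Graph n) where

  cell : Fin n → Fin n → ℕ
  cell x y = if toℕ x <ᵇ toℕ y then γ (dist G x y) else 0

  half : ℕ
  half = sum (λ x → sum (λ y → cell x y))

  private
    if-≤ : ∀ b d → (if b then inv d else 0ℚ) ≤ℚ + (if b then γ d else 0) / 24
    if-≤ true  d = inv-≤ d
    if-≤ false d = ℚ.≤-refl

    if-exact : ∀ b {d} → d ≤ 4 → (if b then inv d else 0ℚ) ≡ + (if b then γ d else 0) / 24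
    if-exact true  d≤4 = inv-exact d≤4
    if-exact false _   = refl

    half-/24 : sumFin (λ x → sumFin (λ y → + cell x y / 24)) ≡ + half / 24
    half-/24 = trans (sumFin-cong λ x → sumFin-/24 (cell x)) (sumFin-/24 (λ x → sum (cell x)))

    cell-≤ : ∀ x y → (if toℕ x <ᵇ toℕ y then inv (dist G x y) else 0ℚ) ≤ℚ + cell x y / 24
    cell-≤ x y = if-≤ (toℕ x <ᵇ toℕ y) (dist G x y)

  harary-≤ : harary G ≤ℚ + half / 24
  harary-≤ = subst (harary G ≤ℚ_) half-/24 (sumFin-mono λ x → sumFin-mono (cell-≤ x))

  harary-exact : (∀ x y → dist G x y ≤ 4) → harary G ≡ + half / 24
  harary-exact diam = trans (sumFin-cong λ x → sumFin-cong λ y → if-exact (toℕ x <ᵇ toℕ y) (diam x y)) half-/24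

  -- One pair at distance above 4 makes its own cell strict and hence the whole double sum.
  ordered-dist≤4 : harary G ≡ + half / 24 → ∀ {x y} → toℕ x < toℕ y → dist G x y ≤ 4
  ordered-dist≤4 tight {x} {y} x<y = ℕ.≮⇒≥ λ 4<d → ℚ.<⇒≢
    (sumFin-mono-< (λ x → sumFin-mono (cell-≤ x)) x (sumFin-mono-< (cell-≤ x) y (strict 4<d)))
    (trans tight (sym half-/24))
    where
    strict : 4 < dist G x y → (if toℕ x <ᵇ toℕ y then inv (dist G x y) else 0ℚ) ℚ.< + cell x y / 24
    -- `suc i ≤ᵇ j` reduces to `i <ᵇ j`, so the rewrite resolves the test in both cells.
    strict 4<d rewrite ≤ᵇ-intro x<y = inv-strict 4<d

  module _ (conn : Connected G) where

    harary-extremal : harary G ≡ + half / 24 → ∀ x y → dist G x y ≤ 4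
    harary-extremal tight x y with ℕ.<-cmp (toℕ x) (toℕ y)
    ... | tri< x<y _ _ = ordered-dist≤4 tight x<y
    ... | tri≈ _ x≡y _ = subst (λ z → dist G x z ≤ 4) (toℕ-injective x≡y) (subst (_≤ 4) (sym (dist-self {G = G} x)) z≤n)
    ... | tri> _ _ y<x = subst (_≤ 4) (dist-sym conn y x) (ordered-dist≤4 tight y<x)

    half-double : half ℕ.+ half ≡ total G
    half-double = begin
      half ℕ.+ half
        ≡⟨ cong (half ℕ.+_) (∑-comm cell) ⟩
      half ℕ.+ sum (λ y → sum (λ x → cell x y))
        ≡⟨ ∑-distrib-+ (λ x → sum (cell x)) (λ x → sum (λ y → cell y x)) ⟨
      sum (λ x → sum (cell x) ℕ.+ sum (λ y → cell y x))
        ≡⟨ sum-cong-≗ (λ x → sym (∑-distrib-+ (cell x) (λ y → cell y x))) ⟩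
      sum (λ x → sum (λ y → cell x y ℕ.+ cell y x))
        ≡⟨ sum-cong-≗ (λ x → sum-cong-≗ (both x)) ⟩
      total G ∎
      where
      open ≡-Reasoning
      both : ∀ x y → cell x y ℕ.+ cell y x ≡ γ (dist G x y)
      both x y with ℕ.<-cmp (toℕ x) (toℕ y)
      ... | tri< x<y _ y≮x rewrite ≤ᵇ-intro x<y | ¬-not {toℕ y <ᵇ toℕ x} (y≮x ∘ ≤ᵇ-true) = ℕ.+-identityʳ _
      ... | tri> x≮y _ y<x rewrite ≤ᵇ-intro y<x | ¬-not {toℕ x <ᵇ toℕ y} (x≮y ∘ ≤ᵇ-true) = cong γ (dist-sym conn y x)
      ... | tri≈ x≮x x≡y _ with toℕ-injective x≡y
      ...   | refl rewrite ¬-not {toℕ x <ᵇ toℕ x} (x≮x ∘ ≤ᵇ-true) = cong γ (sym (dist-self {G = G} x))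

-- The bound as an integer polynomial

polynomial : ℕ → ℕ → ℤ
polynomial n α = + 3 * + n * + n + + 2 * + α * + n + + α * + α - + 9 * + α + + 19 * + n - + 22

-- Adding 9α + 22 clears the negative terms. The right side is half of `bound n α`, which links the
-- integer statement to the estimates in natural numbers.
polynomial+ : ∀ n α → polynomial n α + + (9 ℕ.* α ℕ.+ 22) ≡ + (3 ℕ.* n ℕ.* n ℕ.+ 2 ℕ.* α ℕ.* n ℕ.+ α ℕ.* α ℕ.+ 19 ℕ.* n)
polynomial+ n α = begin
  polynomial n α + + (9 ℕ.* α ℕ.+ 22)
    ≡⟨ cong (λ i → polynomial n α + (i + + 22)) (ℤ.pos-* 9 α) ⟩
  polynomial n α + (+ 9 * + α + + 22)
    ≡⟨ cancel (+ n) (+ α) ⟩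
  + 3 * + n * + n + + 2 * + α * + n + + α * + α + + 19 * + n
    ≡⟨ cong₂ _+_ (cong₂ _+_ (cong₂ _+_ (cube 3 n n) (cube 2 α n)) (sym (ℤ.pos-* α α))) (sym (ℤ.pos-* 19 n)) ⟩
  + (3 ℕ.* n ℕ.* n ℕ.+ 2 ℕ.* α ℕ.* n ℕ.+ α ℕ.* α ℕ.+ 19 ℕ.* n) ∎
  where
  open ≡-Reasoning
  cancel : ∀ i j → + 3 * i * i + + 2 * j * i + j * j - + 9 * j + + 19 * i - + 22 + (+ 9 * j + + 22) ≡
                   + 3 * i * i + + 2 * j * i + j * j + + 19 * i
  cancel = solveℤ
  cube : ∀ a b c → + a * + b * + c ≡ + (a ℕ.* b ℕ.* c)
  cube a b c = trans (cong (_* + c) (sym (ℤ.pos-* a b))) (sym (ℤ.pos-* (a ℕ.* b) c))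

module _ {h n α : ℕ} where

  private
    B = 3 ℕ.* n ℕ.* n ℕ.+ 2 ℕ.* α ℕ.* n ℕ.+ α ℕ.* α ℕ.+ 19 ℕ.* n
    doubled : h ℕ.+ h ℕ.+ (18 ℕ.* α ℕ.+ 44) ≡ 2 ℕ.* (h ℕ.+ (9 ℕ.* α ℕ.+ 22))
    doubled = identity h α
      where
      identity : ∀ h α → h ℕ.+ h ℕ.+ (18 ℕ.* α ℕ.+ 44) ≡ 2 ℕ.* (h ℕ.+ (9 ℕ.* α ℕ.+ 22))
      identity = solve-∀
    k = + (9 ℕ.* α ℕ.+ 22)
    +-cancels : ∀ i → i + k - k ≡ i
    +-cancels i = identity i k
      where
      identity : ∀ i k → i + k - k ≡ i
      identity = solveℤ

  polynomial-≤ : h ℕ.+ h ℕ.+ (18 ℕ.* α ℕ.+ 44) ≤ bound n α → + h ℤ.≤ polynomial n α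
  polynomial-≤ le = ℤ.≤-trans (ℤ.≤-reflexive (sym (+-cancels (+ h))))
    (ℤ.≤-trans (ℤ.+-monoˡ-≤ (ℤ.- k) halved) (ℤ.≤-reflexive (+-cancels (polynomial n α))))
    where
    halved : + h + k ℤ.≤ polynomial n α + k
    halved = ℤ.≤-trans (ℤ.+≤+ (ℕ.*-cancelˡ-≤ 2 (subst (_≤ bound n α) doubled le))) (ℤ.≤-reflexive (sym (polynomial+ n α)))

  polynomial-≡⇒ : + h ≡ polynomial n α → h ℕ.+ h ℕ.+ (18 ℕ.* α ℕ.+ 44) ≡ bound n α
  polynomial-≡⇒ e = trans doubled (cong (2 ℕ.*_) (ℤ.+-injective (trans (cong (_+ k) e) (polynomial+ n α))))

  polynomial-≡⇐ : h ℕ.+ h ℕ.+ (18 ℕ.* α ℕ.+ 44) ≡ bound n α → + h ≡ polynomial n α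
  polynomial-≡⇐ e = trans (sym (+-cancels (+ h))) (trans (cong (_- k) raised) (+-cancels (polynomial n α)))
    where
    raised : + h + k ≡ polynomial n α + k
    raised = trans (cong +_ (ℕ.*-cancelˡ-≡ (h ℕ.+ (9 ℕ.* α ℕ.+ 22)) B 2 (trans (sym doubled) e))) (sym (polynomial+ n α))

theorem3p6 : (n : ℕ) → 2 ≤ n → (T : Graph n) → IsTree T →
    (α : ℕ) → IsIndependenceNumber T α →
    (harary T ≤ℚ ((+ 3 * + n * + n + + 2 * + α * + n + + α * + α - + 9 * + α + + 19 * + n - + 22) / 24))
    × (harary T ≡ ((+ 3 * + n * + n + + 2 * + α * + n + + α * + α - + 9 * + α + + 19 * + n - + 22) / 24) ⇔ T ≅ spur n α)
theorem3p6 n 2≤n T tree@(conn , acyclic) α ind = ℚ.≤-trans (harary-≤ T) half≤ , mk⇔ to from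
  where
  num : IsStabilityNumber T α
  num = independence⇒stability {G = T} ind
  extremality : Extremal T α
  extremality = extremal 2≤n tree num
  half≤ : + half T / 24 ≤ℚ polynomial n α / 24
  half≤ = /24-mono (polynomial-≤ {half T} {n} {α}
    (subst (λ w → w ℕ.+ (18 ℕ.* α ℕ.+ 44) ≤ bound n α) (sym (half-double T conn)) (proj₁ extremality)))
  to : harary T ≡ polynomial n α / 24 → T ≅ spur n α
  to tight = extremal-isomorphic {G = T} acyclic num (proj₂ extremality (ℕ.≤-reflexive (sym total≡))
      (harary-extremal T conn (trans tight (sym half≡))))
    where
    -- Equality squeezes both links of the chain through `half`: this one gives the tight total, and
    -- the other one, via `harary-extremal`, the diameter bound.
    half≡ : + half T / 24 ≡ polynomial n α / 24
    half≡ = ℚ.≤-antisym half≤ (subst (_≤ℚ + half T / 24) tight (harary-≤ T))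
    total≡ : total T ℕ.+ (18 ℕ.* α ℕ.+ 44) ≡ bound n α
    total≡ = trans (cong (ℕ._+ (18 ℕ.* α ℕ.+ 44)) (sym (half-double T conn)))
      (polynomial-≡⇒ {half T} {n} {α} (/24-injective half≡))
  from : T ≅ spur n α → harary T ≡ polynomial n α / 24
  from iso with extremal-spur {G = T} 2≤n conn num iso
  ... | total≡ , diam = trans (harary-exact T diam) (cong (_/ 24) (polynomial-≡⇐ {half T} {n} {α}
    (trans (cong (ℕ._+ (18 ℕ.* α ℕ.+ 44)) (half-double T conn)) total≡)))
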